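{- Let $G$ be a loopless non-bipartite multigraph, let $d>1$ be an odd integer, and let $\Delta(G)=md+s$, where $m\ge 0$ and $0\le s<d$ are integers. Let \[ \ell:=\max\{1,\Gamma_d(G)-m\}. \] Then $\ell d-s>0$. If moreover \[ g_0(G)\ge\left\lceil\frac{m+\ell-1}{\ell d-s}\right\rceil, \] then $\chi'_d(G)\le m+\ell$, and hence \[ \chi'_d(G)\le\max\left\{\Gamma_d(G),\left\lceil\frac{\Delta(G)+1}{d}\right\rceil\right\}. \]
   Context: Multigraphs are finite; parallel edges are allowed, loops are not. $\Delta(G)$ is the maximum degree of $G$, where degrees count edges with multiplicity. For a non-bipartite multigraph $G$, the odd girth $g_0(G)$ is the length of a shortest odd cycle of $G$. For a positive integer $d$, a $d$-defective edge coloring of $G$ is an assignment of colors to the edges of $G$ such that, for each color, the subgraph formed by the edges of that color has maximum degree at most $d$. The $d$-defective chromatic index $\chi'_d(G)$ is the least $k$ such that $G$ has a $d$-defective edge coloring using at most $k$ colors. The $d$-defective density of $G$ is \[ \Gamma_d(G):=\max\left\{\left\lceil\frac{|E(G[X])|}{\lfloor d|X|/2\rfloor}\right\rceil : X\subseteq V(G),\ |X|>2\right\}, \] where $G[X]$ is the subgraph of $G$ induced by $X$ and $|E(G[X])|$ counts edges with multiplicity. -}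

module Defs where

open import Data.Bool.Base using (Bool; true; false)
open import Data.Empty using (⊥-elim)
open import Data.Fin.Base using (Fin; zero; suc; toℕ)
import Data.Fin.Properties as Fin
open import Data.Fin.Subset using (Subset; inside; outside; ∣_∣)
open import Data.Fin.Subset.Properties using (_∈?_)
open import Data.List.Base as List using (List; []; _∷_; [_]; filter; length; allFin; cartesianProductWith)
open import Data.List.Extrema.Nat using (max; max≤v⁺)
open import Data.List.Membership.Propositional using (_∈_; find; lose)
open import Data.List.Membership.Propositional.Properties using (∈-cartesianProductWith⁺; ∈-allFin)
open import Data.List.Properties using (length-filter)
open import Data.List.Relation.Unary.All as All using (All; []; _∷_)
import Data.List.Relation.Unary.All.Properties as All
open import Data.List.Relation.Unary.Any as Any using (here; there)
open import Data.List.Relation.Unary.AllPairs using ([]; _∷_)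
open import Data.List.Relation.Unary.Unique.Propositional using () renaming (Unique to UniqueList)
import Data.List.Relation.Unary.Unique.Propositional.Properties as UniqueList
open import Data.Nat.Base
open import Data.Nat.DivMod using (_mod_; m≥n⇒m/n>0)
open import Data.Nat.Divisibility using (_∣_; _∣?_)
open import Data.Nat.Properties using (_≤?_; _<?_; ≤-refl; ≤-trans; *-mono-≤; n≤1+n)
open import Data.Product.Base using (∃; _×_; _,_; proj₁; proj₂)
open import Data.Product.Properties using (≡-dec)
open import Data.Sum.Base using (_⊎_)
open import Data.Vec.Base using (Vec; []; _∷_; lookup; tabulate)
open import Data.Vec.Properties using (lookup∘tabulate)
open import Data.Vec.Relation.Unary.AllPairs using (allPairs?)
open import Data.Vec.Relation.Unary.Unique.Propositional using (Unique)
import Data.Vec.Relation.Unary.Unique.Propositional.Properties as Unique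
open import Function.Base using (_∘_)
open import Level using (0ℓ)
open import Relation.Binary.PropositionalEquality using (_≡_; _≢_; refl; sym; trans)
open import Relation.Nullary using (Dec; yes; no; ¬_)
open import Relation.Nullary.Decidable using (map′; ¬?; _×-dec_; _⊎-dec_)
open import Relation.Unary using (Pred; Decidable)

Odd : ℕ → Set
Odd k = ¬ (2 ∣ k)

odd? : Decidable Odd
odd? k = ¬? (2 ∣? k)

⌈_/_⌉ : (a b : ℕ) .{{_ : NonZero b}} → ℕ
⌈ a / b ⌉ = (a + (b ∸ 1)) / b

-- The least k ≤ b satisfying P; it is b if there is no such k.
least : {P : Pred ℕ 0ℓ} → Decidable P → ℕ → ℕ
least P? zero = zero
least P? (suc b) with P? zero
... | yes _ = zero
... | no  _ = suc (least (P? ∘ suc) b)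

least-minimal : {P : Pred ℕ 0ℓ} (P? : Decidable P) (b : ℕ) {k : ℕ} → P k → least P? b ≤ k
least-minimal P? zero    Pk = z≤n
least-minimal P? (suc b) {k} Pk with P? zero
... | yes _ = z≤n
least-minimal P? (suc b) {zero}  Pk | no ¬P0 = ⊥-elim (¬P0 Pk)
least-minimal P? (suc b) {suc k} Pk | no _   = s≤s (least-minimal (P? ∘ suc) b Pk)

least-satisfies : {P : Pred ℕ 0ℓ} (P? : Decidable P) (b : ℕ) {k : ℕ} → k ≤ b → P k → P (least P? b)
least-satisfies P? zero    z≤n Pk = Pk
least-satisfies P? (suc b) k≤b Pk with P? zero
... | yes P0 = P0
least-satisfies P? (suc b) {zero}  k≤b       Pk | no ¬P0 = ⊥-elim (¬P0 Pk)
least-satisfies P? (suc b) {suc k} (s≤s k≤b) Pk | no _   = least-satisfies (P? ∘ suc) b k≤b Pk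

vecs : {A : Set} → List A → (n : ℕ) → List (Vec A n)
vecs xs zero    = [ [] ]
vecs xs (suc n) = cartesianProductWith _∷_ xs (vecs xs n)

∈-vecs : {A : Set} {xs : List A} → (∀ x → x ∈ xs) → ∀ {n} (v : Vec A n) → v ∈ vecs xs n
∈-vecs all∈ []      = here refl
∈-vecs all∈ (x ∷ v) = ∈-cartesianProductWith⁺ _∷_ (all∈ x) (∈-vecs all∈ v)

anyVec? : ∀ {k n} {P : Pred (Vec (Fin k) n) 0ℓ} → Decidable P → Dec (∃ P)
anyVec? {k} {n} P? = map′ (λ p → let v , _ , Pv = find p in v , Pv)
                          (λ (v , Pv) → lose (∈-vecs ∈-allFin v) Pv)
                          (Any.any? P? (vecs (allFin k) n))

subsets : (n : ℕ) → List (Subset n)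
subsets = vecs (outside ∷ inside ∷ [])

∈-subsets : ∀ {n} (X : Subset n) → X ∈ subsets n
∈-subsets = ∈-vecs λ { false → here refl ; true → there (here refl) }

-- Vertices are Fin order and edges are Fin size, so distinct edges may have the same ends.
-- The order in which the two ends of an edge are listed carries no meaning.
record Multigraph : Set where
  field
    order    : ℕ
    size     : ℕ
    ends     : Fin size → Fin order × Fin order
    loopless : ∀ f → proj₁ (ends f) ≢ proj₂ (ends f)

  Vertex : Set
  Vertex = Fin order

  Edge : Set
  Edge = Fin size

module _ (G : Multigraph) where
  open Multigraph G

  Bipartite : Set
  Bipartite = ∃ λ (side : Vertex → Bool) → ∀ f → side (proj₁ (ends f)) ≢ side (proj₂ (ends f))

  Incident : Vertex → Edge → Set
  Incident v f = proj₁ (ends f) ≡ v ⊎ proj₂ (ends f) ≡ v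

  incident? : ∀ v → Decidable (Incident v)
  incident? v f = (proj₁ (ends f) Fin.≟ v) ⊎-dec (proj₂ (ends f) Fin.≟ v)

  -- Degrees in the spanning subgraph whose edges are those in a (repetition-free) list.
  degreeIn : List Edge → Vertex → ℕ
  degreeIn es v = length (filter (incident? v) es)

  maxDegreeIn : List Edge → ℕ
  maxDegreeIn es = max 0 (List.map (degreeIn es) (allFin order))

  Δ : ℕ
  Δ = maxDegreeIn (allFin size)

  inducedEdges : Subset order → List Edge
  inducedEdges X = filter (λ f → (proj₁ (ends f) ∈? X) ×-dec (proj₂ (ends f) ∈? X)) (allFin size)

  Joins : Edge → Vertex → Vertex → Set
  Joins f u v = ends f ≡ (u , v) ⊎ ends f ≡ (v , u)

  joins? : ∀ f u v → Dec (Joins f u v)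
  joins? f u v = ≡-dec Fin._≟_ Fin._≟_ (ends f) (u , v) ⊎-dec ≡-dec Fin._≟_ Fin._≟_ (ends f) (v , u)

-- i + 1 modulo k
next : ∀ {k} → Fin k → Fin k
next {suc k} i = suc (toℕ i) mod suc k

module _ (G : Multigraph) where
  open Multigraph G

  -- Distinct vertices v₀ … vₖ₋₁ and distinct edges e₀ … eₖ₋₁ with eᵢ joining vᵢ and vᵢ₊₁, indices
  -- modulo k. By looplessness k ≢ 1; the degenerate k = 0 is excluded below by parity.
  IsCycle : ∀ {k} → Vec Vertex k → Vec Edge k → Set
  IsCycle vs es = Unique vs × Unique es × (∀ i → Joins G (lookup es i) (lookup vs i) (lookup vs (next i)))

  isCycle? : ∀ {k} (vs : Vec Vertex k) (es : Vec Edge k) → Dec (IsCycle vs es)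
  isCycle? vs es = allPairs? (λ u v → ¬? (u Fin.≟ v)) vs
             ×-dec allPairs? (λ e f → ¬? (e Fin.≟ f)) es
             ×-dec Fin.all? (λ i → joins? G (lookup es i) (lookup vs i) (lookup vs (next i)))

  HasOddCycle : ℕ → Set
  HasOddCycle k = Odd k × (∃ λ (vs : Vec Vertex k) → ∃ λ (es : Vec Edge k) → IsCycle vs es)

  hasOddCycle? : Decidable HasOddCycle
  hasOddCycle? k = odd? k ×-dec anyVec? λ vs → anyVec? λ es → isCycle? vs es

  -- Cycles have at most order-many vertices, so searching up to that bound loses nothing; the
  -- value is only meaningful when an odd cycle exists, that is, when G is not bipartite.
  g₀ : ℕ
  g₀ = least hasOddCycle? order

  g₀-minimal : ∀ {k} → HasOddCycle k → g₀ ≤ k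
  g₀-minimal = least-minimal hasOddCycle? order

  g₀-attained : ∀ {k} → HasOddCycle k → HasOddCycle g₀
  g₀-attained {k} c@(_ , vs , _ , distinct , _) = least-satisfies hasOddCycle? order k≤order c
    where
    k≤order : k ≤ order
    k≤order = Fin.injective⇒≤ {f = lookup vs} (Unique.lookup-injective distinct _ _)

  colourClass : ∀ {k} → Vec (Fin k) size → Fin k → List Edge
  colourClass c a = filter (λ f → lookup c f Fin.≟ a) (allFin size)

  IsDefective : (d : ℕ) → ∀ {k} → Vec (Fin k) size → Set
  IsDefective d c = ∀ a → maxDegreeIn G (colourClass c a) ≤ d

  DefectiveColourable : (d k : ℕ) → Set
  DefectiveColourable d k = ∃ λ (c : Vec (Fin k) size) → IsDefective d c

  defectiveColourable? : ∀ d → Decidable (DefectiveColourable d)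
  defectiveColourable? d k = anyVec? λ c → Fin.all? λ a → maxDegreeIn G (colourClass c a) ≤? d

  -- For d ≥ 1 the search bound size is harmless: giving each edge its own colour is a
  -- d-defective colouring.
  χ′ : (d : ℕ) → ℕ
  χ′ d = least (defectiveColourable? d) size

  χ′-minimal : ∀ d {k} → DefectiveColourable d k → χ′ d ≤ k
  χ′-minimal d = least-minimal (defectiveColourable? d) size

  χ′-attained : ∀ d .{{_ : NonZero d}} → DefectiveColourable d (χ′ d)
  χ′-attained d = least-satisfies (defectiveColourable? d) size ≤-refl (c , λ a → max≤v⁺ z≤n (All.map⁺ (All.universal (bound a) (allFin order))))
    where
    c : Vec (Fin size) size
    c = tabulate λ f → f

    constant⇒≤1 : ∀ {a} {fs : List Edge} → UniqueList fs → All (_≡ a) fs → length fs ≤ 1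
    constant⇒≤1 [] [] = z≤n
    constant⇒≤1 ([] ∷ _) (_ ∷ []) = s≤s z≤n
    constant⇒≤1 ((x≢y ∷ _) ∷ _) (x≡a ∷ y≡a ∷ _) = ⊥-elim (x≢y (trans x≡a (sym y≡a)))

    class≤1 : ∀ a → length (colourClass c a) ≤ 1
    class≤1 a = constant⇒≤1
      (UniqueList.filter⁺ _ (UniqueList.allFin⁺ size))
      (All.map (λ {f} → trans (sym (lookup∘tabulate (λ g → g) f))) (All.all-filter (λ f → lookup c f Fin.≟ a) (allFin size)))

    bound : ∀ a v → degreeIn G (colourClass c a) v ≤ d
    bound a v = ≤-trans (length-filter (incident? G v) (colourClass c a)) (≤-trans (class≤1 a) (>-nonZero⁻¹ d))

⌊d*x/2⌋-nonZero : ∀ {d x} .{{_ : NonZero d}} → 2 < x → NonZero (d * x / 2)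
⌊d*x/2⌋-nonZero {d} 2<x = >-nonZero (m≥n⇒m/n>0 (*-mono-≤ (>-nonZero⁻¹ d) (≤-trans (n≤1+n 2) 2<x)))

-- The term of the maximum contributed by X; sets with |X| ≤ 2 contribute 0, which does not
-- affect the maximum since all other terms are natural numbers.
densityTerm : (G : Multigraph) (d : ℕ) .{{_ : NonZero d}} → Subset (Multigraph.order G) → ℕ
densityTerm G d X with 2 <? ∣ X ∣
... | yes 2<∣X∣ = ⌈_/_⌉ (length (inducedEdges G X)) (d * ∣ X ∣ / 2) {{⌊d*x/2⌋-nonZero 2<∣X∣}}
... | no  _     = 0

Γ : (G : Multigraph) (d : ℕ) .{{_ : NonZero d}} → ℕ
Γ G d = max 0 (List.map (densityTerm G d) (subsets (Multigraph.order G)))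

{-# OPTIONS --safe #-}

-- Write k = m + ℓ and D = kd − Δ(G) = ℓd − s > 0. Take a partial d-defective colouring with k colours and as few
-- uncoloured edges as possible, and suppose that xy is uncoloured. A vertex misses a colour if fewer than d of its
-- edges have it. Swapping two colours along alternating trails shows that the ends of an uncoloured edge miss no
-- common colour, and that they have exactly d − 1 edges of each colour they miss.
-- Let x miss α and y miss β. Shifting the uncoloured edge along an αβ-alternating trail must lead back to y after an
-- odd number of steps, which yields an odd cycle C each of whose edges can be made uncoloured by recolouring
-- within α and β. By a Kempe-change induction on distance no colour other than α, β is missed at two vertices
-- of C, while each vertex of C misses at least D of them. Hence |C| D ≤ k − 2, against g₀(G) D ≥ k − 1.
module Submission where

open import Defs
open import Data.Empty using (⊥; ⊥-elim)
open import Data.Fin.Base using (Fin; zero; suc; toℕ; fromℕ; inject₁; punchOut)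
import Data.Fin.Properties as Fin
open import Data.Fin.Relation.Unary.Top using (view; ‵fromℕ; ‵inject₁)
open import Data.List.Base as List using (filter; length; allFin)
open import Data.List.Extrema.Nat using (max≤v⁺; xs≤max)
open import Data.List.Membership.Propositional.Properties using (∈-allFin)
import Data.List.Relation.Unary.All as ListAll using (universal; lookup)
import Data.List.Relation.Unary.All.Properties as ListAll using (map⁺; map⁻)
open import Data.Nat.Base using (ℕ; zero; suc; _+_; _*_; _∸_; _⊔_; _%_; _≤_; _<_; _≥_; _>_; z≤n; s≤s; parity; NonZero; >-nonZero)
open import Data.Nat.Divisibility using (divides)
open import Data.Nat.DivMod using (m%n<n; n%n≡0; m≡m%n+[m/n]*n; m<n⇒m%n≡m)
open import Data.Nat.Properties
open import Data.Nat.Tactic.RingSolver using (solve-∀)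
open import Data.Parity.Base using (Parity; 0ℙ; 1ℙ; _⁻¹) renaming (_+_ to _+ℙ_; _*_ to _*ℙ_)
open import Data.Parity.Properties using (suc-homo-⁻¹; +-homo-+; *-homo-*; ⁻¹-involutive) renaming (*-zeroʳ to *ℙ-zeroʳ)
open import Data.Product.Base using (Σ; ∃; _×_; _,_; proj₁; proj₂)
open import Data.Sum.Base using (_⊎_; inj₁; inj₂)
open import Data.Vec.Base using (Vec; []; _∷_; lookup; tabulate; _∷ʳ_)
open import Data.Vec.Properties using (tabulate∘lookup; lookup∘tabulate)
open import Data.Vec.Relation.Unary.All using (All; []; _∷_)
import Data.Vec.Relation.Unary.All.Properties as All
open import Data.Vec.Relation.Unary.AllPairs using ([]; _∷_)
open import Data.Vec.Relation.Unary.Unique.Propositional using (Unique)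
open import Data.Vec.Relation.Unary.Unique.Propositional.Properties using (tabulate⁺; lookup-injective)
open import Function.Base using (_∘_; case_of_)
open import Relation.Binary.Construct.Closure.ReflexiveTransitive using (Star; _◅_; _◅◅_)
open import Relation.Binary.PropositionalEquality using (_≡_; _≢_; refl; sym; trans; cong; cong₂; subst; subst₂; module ≡-Reasoning)
open import Relation.Nullary using (Dec; yes; no; ¬_)
open import Relation.Nullary.Decidable using (¬?; _×-dec_; decidable-stable)

open import Algebra.Properties.CommutativeMonoid.Sum +-0-commutativeMonoid using (sum; sum-cong-≗; ∑-distrib-+; ∑-comm)
open import Algebra.Properties.Semiring.Sum +-*-semiring using (*-distribˡ-sum)

-- A vertex may carry up to `d` edges of each of two colours, so the subgraph of two colours need
-- not split into paths and cycles, and an alternating trail may pass through a vertex many times.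
-- This shapes the proof in three places. A swapped trail stops only where, among the edges not yet
-- traversed, the colour of the entering edge outnumbers the other colour; this excess is what keeps
-- the swapped colouring valid. The closed trail of shifts need not be a cycle: as it is built up
-- backwards from its end, even cycles are discarded, which preserves parity, and a simple path from
-- y to y has no edges, so at some point an odd cycle must appear. Finally, different edges of C
-- become uncoloured in different colourings; these all have the same classes outside α and β, so
-- the other colours missed on C can be compared in a single colouring.

private
  variable
    n : ℕ
    A B : Set

-- Indicators and finite sums

ι : Dec A → ℕ
ι (yes _) = 1
ι (no _)  = 0

ι-yes : (A? : Dec A) → A → ι A? ≡ 1
ι-yes (yes _) _ = refl
ι-yes (no ¬a) a = ⊥-elim (¬a a)

ι-no : (A? : Dec A) → ¬ A → ι A? ≡ 0
ι-no (yes a) ¬a = ⊥-elim (¬a a)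
ι-no (no _)  _  = refl

ι-mono : (A? : Dec A) (B? : Dec B) → (A → B) → ι A? ≤ ι B?
ι-mono (yes a) B? f = ≤-reflexive (sym (ι-yes B? (f a)))
ι-mono (no _)  B? f = z≤n

ι-cong : (A? : Dec A) (B? : Dec B) → (A → B) → (B → A) → ι A? ≡ ι B?
ι-cong A? B? f g = ≤-antisym (ι-mono A? B? f) (ι-mono B? A? g)

sum-mono : {f g : Fin n → ℕ} → (∀ i → f i ≤ g i) → sum f ≤ sum g
sum-mono {zero}  f≤g = z≤n
sum-mono {suc n} f≤g = +-mono-≤ (f≤g zero) (sum-mono (f≤g ∘ suc))

sum-const : ∀ n x → sum {n} (λ _ → x) ≡ n * x
sum-const zero    x = refl
sum-const (suc n) x = cong (x +_) (sum-const n x)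

sum-zero : {f : Fin n → ℕ} → (∀ i → f i ≡ 0) → sum f ≡ 0
sum-zero {n} f≡0 = trans (sum-cong-≗ f≡0) (trans (sum-const n 0) (*-zeroʳ n))

sum-≟ : (i : Fin n) → sum (λ j → ι (i Fin.≟ j)) ≡ 1
sum-≟ {suc n} zero    = cong suc (sum-zero {n} (λ _ → refl))
sum-≟ {suc n} (suc i) = trans (sum-cong-≗ λ j → ι-cong (suc i Fin.≟ suc j) (i Fin.≟ j) Fin.suc-injective (cong suc)) (sum-≟ i)

term≤sum : (f : Fin n → ℕ) (i : Fin n) → f i ≤ sum f
term≤sum f zero    = m≤m+n _ _
term≤sum f (suc i) = ≤-trans (term≤sum (f ∘ suc) i) (m≤n+m _ _)

sum≡0∨term : (f : Fin n → ℕ) → sum f ≡ 0 ⊎ ∃ λ i → f i > 0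
sum≡0∨term f with Fin.any? (λ i → 0 <? f i)
... | yes p = inj₂ p
... | no ¬p = inj₁ (sum-zero λ i → n≤0⇒n≡0 (≮⇒≥ (λ 0<fi → ¬p (i , 0<fi))))

-- The two values at i are moved across so that nothing is subtracted.
sum-exchange : (f g : Fin n → ℕ) (i : Fin n) → (∀ j → j ≢ i → f j ≡ g j) → sum f + g i ≡ sum g + f i
sum-exchange f g zero f≡g = begin
  (f zero + sum (f ∘ suc)) + g zero  ≡⟨ cong (λ s → (f zero + s) + g zero) (sum-cong-≗ λ j → f≡g (suc j) λ ()) ⟩
  (f zero + sum (g ∘ suc)) + g zero  ≡⟨ swap-ends (f zero) _ (g zero) ⟩
  (g zero + sum (g ∘ suc)) + f zero  ∎
  where
  open ≡-Reasoning
  swap-ends : ∀ a b c → (a + b) + c ≡ (c + b) + a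
  swap-ends = solve-∀
sum-exchange f g (suc i) f≡g = begin
  (f zero + sum (f ∘ suc)) + g (suc i)  ≡⟨ +-assoc (f zero) _ _ ⟩
  f zero + (sum (f ∘ suc) + g (suc i))  ≡⟨ cong₂ _+_ (f≡g zero λ ()) (sum-exchange (f ∘ suc) (g ∘ suc) i λ j j≢i → f≡g (suc j) (j≢i ∘ Fin.suc-injective)) ⟩
  g zero + (sum (g ∘ suc) + f (suc i))  ≡⟨ sym (+-assoc (g zero) _ _) ⟩
  (g zero + sum (g ∘ suc)) + f (suc i)  ∎
  where open ≡-Reasoning

sum-ι≤1 : {P : Fin n → Set} (P? : ∀ i → Dec (P i)) → (∀ i j → P i → P j → i ≡ j) → sum (λ i → ι (P? i)) ≤ 1
sum-ι≤1 {zero}  P? unique = z≤n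
sum-ι≤1 {suc n} P? unique with P? zero
... | yes p = s≤s (≤-reflexive (sum-zero λ i → ι-no (P? (suc i)) λ q → Fin.0≢1+n (unique zero (suc i) p q)))
... | no _  = sum-ι≤1 (P? ∘ suc) λ i j p q → Fin.suc-injective (unique (suc i) (suc j) p q)

length-filter-tabulate : {P : A → Set} (P? : ∀ x → Dec (P x)) (h : Fin n → A) → length (filter P? (List.tabulate h)) ≡ sum (λ i → ι (P? (h i)))
length-filter-tabulate {n = zero}  P? h = refl
length-filter-tabulate {n = suc n} P? h with P? (h zero)
... | yes _ = cong suc (length-filter-tabulate P? (h ∘ suc))
... | no _  = length-filter-tabulate P? (h ∘ suc)

length-filter-filter≤ : {P Q : A → Set} (P? : ∀ x → Dec (P x)) (Q? : ∀ x → Dec (Q x)) (h : Fin n → A) {w : Fin n → ℕ} →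
  (∀ i → P (h i) → Q (h i) → 1 ≤ w i) → length (filter P? (filter Q? (List.tabulate h))) ≤ sum w
length-filter-filter≤ {n = zero}  P? Q? h counted = z≤n
length-filter-filter≤ {n = suc n} P? Q? h {w} counted with Q? (h zero)
... | no _  = ≤-trans (length-filter-filter≤ P? Q? (h ∘ suc) (counted ∘ suc)) (m≤n+m _ (w zero))
... | yes q with P? (h zero)
...   | no _  = ≤-trans (length-filter-filter≤ P? Q? (h ∘ suc) (counted ∘ suc)) (m≤n+m _ (w zero))
...   | yes p = +-mono-≤ (counted zero p q) (length-filter-filter≤ P? Q? (h ∘ suc) (counted ∘ suc))

-- Parity and cyclic indices

parity-suc : ∀ n → parity (suc n) ≡ parity n ⁻¹
parity-suc zero    = refl
parity-suc (suc n) = sym (suc-homo-⁻¹ n)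

even⇒odd-suc : parity n ≡ 0ℙ → Odd (suc n)
even⇒odd-suc {n} even (divides q eq) = case begin
  1ℙ                     ≡⟨ cong _⁻¹ even ⟨
  parity n ⁻¹            ≡⟨ parity-suc n ⟨
  parity (suc n)         ≡⟨ cong parity eq ⟩
  parity (q * 2)         ≡⟨ *-homo-* q 2 ⟩
  parity q *ℙ 0ℙ         ≡⟨ *ℙ-zeroʳ (parity q) ⟩
  0ℙ                     ∎ of λ ()
  where open ≡-Reasoning

next-fromℕ : ∀ n → next (fromℕ n) ≡ zero
next-fromℕ n = Fin.toℕ-injective (begin
  toℕ (next (fromℕ n))            ≡⟨ Fin.toℕ-fromℕ< (m%n<n (suc (toℕ (fromℕ n))) (suc n)) ⟩
  suc (toℕ (fromℕ n)) % suc n     ≡⟨ cong (λ m → suc m % suc n) (Fin.toℕ-fromℕ n) ⟩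
  suc n % suc n                   ≡⟨ n%n≡0 (suc n) ⟩
  0                               ∎)
  where open ≡-Reasoning

next-inject₁ : (i : Fin n) → next (inject₁ i) ≡ suc i
next-inject₁ {n} i = Fin.toℕ-injective (begin
  toℕ (next (inject₁ i))          ≡⟨ Fin.toℕ-fromℕ< (m%n<n (suc (toℕ (inject₁ i))) (suc n)) ⟩
  suc (toℕ (inject₁ i)) % suc n   ≡⟨ cong (λ m → suc m % suc n) (Fin.toℕ-inject₁ i) ⟩
  suc (toℕ i) % suc n             ≡⟨ m<n⇒m%n≡m (s≤s (Fin.toℕ<n i)) ⟩
  suc (toℕ i)                     ∎)
  where open ≡-Reasoning

next-next≢ : (i : Fin (suc (suc (suc n)))) → next (next i) ≢ i
next-next≢ {n} i eq with view i
... | ‵fromℕ = case trans (sym (trans (cong next (next-fromℕ _)) (next-inject₁ zero))) eq of λ ()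
... | ‵inject₁ j with view j
...   | ‵fromℕ = case trans (sym (trans (cong next (next-inject₁ j)) (next-fromℕ _))) eq of λ ()
...   | ‵inject₁ l = m≢1+n+m (toℕ l) {1} (begin
  toℕ l                          ≡⟨ Fin.toℕ-inject₁ l ⟨
  toℕ (inject₁ l)                ≡⟨ Fin.toℕ-inject₁ (inject₁ l) ⟨
  toℕ (inject₁ (inject₁ l))      ≡⟨ cong toℕ (trans (sym eq) (trans (cong next (next-inject₁ (inject₁ l))) (next-inject₁ (suc l)))) ⟩
  suc (suc (toℕ l))              ∎)
  where open ≡-Reasoning

-- Two steps return to the start only in lengths 1 and 2, and an odd length rules out 2. `close`
-- uses this to see that an odd cycle traverses no edge back and forth.
next-next-fixed : parity n ≡ 0ℙ → (i : Fin (suc n)) → next (next i) ≡ i → ∀ j → i ≡ j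
next-next-fixed {zero}        even zero fixed zero = refl
next-next-fixed {suc (suc n)} even i fixed j = ⊥-elim (next-next≢ i fixed)

lookup-∷ʳ-fromℕ : ∀ (xs : Vec A n) {x} → lookup (xs ∷ʳ x) (fromℕ n) ≡ x
lookup-∷ʳ-fromℕ []       = refl
lookup-∷ʳ-fromℕ (_ ∷ xs) = lookup-∷ʳ-fromℕ xs

lookup-∷ʳ-inject₁ : ∀ (xs : Vec A n) {x} i → lookup (xs ∷ʳ x) (inject₁ i) ≡ lookup xs i
lookup-∷ʳ-inject₁ (_ ∷ xs) zero    = refl
lookup-∷ʳ-inject₁ (_ ∷ xs) (suc i) = lookup-∷ʳ-inject₁ xs i

-- Recolouring a single edge

module _ {E : ℕ} {C : ℕ} where

  _[_≔_] : (Fin E → Fin C) → Fin E → Fin C → Fin E → Fin C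
  (c [ f ≔ x ]) g with g Fin.≟ f
  ... | yes _ = x
  ... | no _  = c g

  ≔-here : ∀ c f x → (c [ f ≔ x ]) f ≡ x
  ≔-here c f x with f Fin.≟ f
  ... | yes _  = refl
  ... | no f≢f = ⊥-elim (f≢f refl)

  ≔-there : ∀ c {f} x {g} → g ≢ f → (c [ f ≔ x ]) g ≡ c g
  ≔-there c {f} x {g} g≢f with g Fin.≟ f
  ... | yes g≡f = ⊥-elim (g≢f g≡f)
  ... | no _    = refl

  private
    +*ι-yes : ∀ s m (A? : Dec A) → A → s + m * ι A? ≡ s + m
    +*ι-yes s m A? a = cong (s +_) (trans (cong (m *_) (ι-yes A? a)) (*-identityʳ m))

    +*ι-no : ∀ s m (A? : Dec A) → ¬ A → s + m * ι A? ≡ s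
    +*ι-no s m A? ¬a = trans (cong (s +_) (trans (cong (m *_) (ι-no A? ¬a)) (*-zeroʳ m))) (+-identityʳ s)

  opaque

    -- The weight lets one set of recolouring laws serve twice: `inc t` gives the colour degrees at
    -- `t`, the constant 1 gives the sizes of colour classes.
    count : (Fin E → ℕ) → (Fin E → Fin C) → Fin C → ℕ
    count w c γ = sum λ g → w g * ι (c g Fin.≟ γ)

    count-def : ∀ w c γ → count w c γ ≡ sum (λ g → w g * ι (c g Fin.≟ γ))
    count-def w c γ = refl

    count-cong : ∀ w {c c′ γ} → (∀ g → c g ≡ γ → c′ g ≡ γ) → (∀ g → c′ g ≡ γ → c g ≡ γ) → count w c γ ≡ count w c′ γ
    count-cong w c⇒c′ c′⇒c = sum-cong-≗ λ g → cong (w g *_) (ι-cong _ _ (c⇒c′ g) (c′⇒c g))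

    count-≔ : ∀ w c f x γ → count w (c [ f ≔ x ]) γ + w f * ι (c f Fin.≟ γ) ≡ count w c γ + w f * ι (x Fin.≟ γ)
    count-≔ w c f x γ = trans
      (sum-exchange (λ g → w g * ι ((c [ f ≔ x ]) g Fin.≟ γ)) (λ g → w g * ι (c g Fin.≟ γ)) f
        λ j j≢f → cong (λ y → w j * ι (y Fin.≟ γ)) (≔-there c x j≢f))
      (cong (λ y → count w c γ + w f * ι (y Fin.≟ γ)) (≔-here c f x))

    count-term : ∀ w c f → w f ≤ count w c (c f)
    count-term w c f = ≤-trans (≤-reflexive (sym (trans (cong (w f *_) (ι-yes (c f Fin.≟ c f) refl)) (*-identityʳ (w f)))))
      (term≤sum (λ g → w g * ι (c g Fin.≟ c f)) f)

    count≡0∨edge : ∀ w c γ → count w c γ ≡ 0 ⊎ ∃ λ g → w g > 0 × c g ≡ γ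
    count≡0∨edge w c γ with sum≡0∨term (λ g → w g * ι (c g Fin.≟ γ))
    ... | inj₁ ≡0 = inj₁ ≡0
    ... | inj₂ (g , pos) with c g Fin.≟ γ
    ...   | yes eq = inj₂ (g , subst (_> 0) (*-identityʳ (w g)) pos , eq)
    ...   | no _   = ⊥-elim (<-irrefl refl (subst (_> 0) (*-zeroʳ (w g)) pos))

    count-total : ∀ w c → sum (λ γ → count w c γ) ≡ sum w
    count-total w c = begin
      sum (λ γ → sum λ g → w g * ι (c g Fin.≟ γ))  ≡⟨ ∑-comm (λ γ g → w g * ι (c g Fin.≟ γ)) ⟩
      sum (λ g → sum λ γ → w g * ι (c g Fin.≟ γ))  ≡⟨ sum-cong-≗ (λ g → sym (*-distribˡ-sum (w g) (λ γ → ι (c g Fin.≟ γ)))) ⟩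
      sum (λ g → w g * sum λ γ → ι (c g Fin.≟ γ))  ≡⟨ sum-cong-≗ (λ g → trans (cong (w g *_) (sum-≟ (c g))) (*-identityʳ (w g))) ⟩
      sum w                                       ∎
      where open ≡-Reasoning

  count-other : ∀ w c {f x γ} → c f ≢ γ → x ≢ γ → count w (c [ f ≔ x ]) γ ≡ count w c γ
  count-other w c {f} {x} {γ} cf≢γ x≢γ = subst₂ _≡_
    (+*ι-no (count w (c [ f ≔ x ]) γ) (w f) (c f Fin.≟ γ) cf≢γ)
    (+*ι-no (count w c γ) (w f) (x Fin.≟ γ) x≢γ)
    (count-≔ w c f x γ)

  count-gain : ∀ w c {f γ} → c f ≢ γ → count w (c [ f ≔ γ ]) γ ≡ count w c γ + w f
  count-gain w c {f} {γ} cf≢γ = subst₂ _≡_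
    (+*ι-no (count w (c [ f ≔ γ ]) γ) (w f) (c f Fin.≟ γ) cf≢γ)
    (+*ι-yes (count w c γ) (w f) (γ Fin.≟ γ) refl)
    (count-≔ w c f γ γ)

  count-loss : ∀ w c {f x γ} → c f ≡ γ → x ≢ γ → count w (c [ f ≔ x ]) γ + w f ≡ count w c γ
  count-loss w c {f} {x} {γ} cf≡γ x≢γ = subst₂ _≡_
    (+*ι-yes (count w (c [ f ≔ x ]) γ) (w f) (c f Fin.≟ γ) cf≡γ)
    (+*ι-no (count w c γ) (w f) (x Fin.≟ γ) x≢γ)
    (count-≔ w c f x γ)

-- Incidence and degrees

module _ (G : Multigraph) where
  open Multigraph G

  infix 7 _≐_

  _≐_ : Vertex → Vertex → ℕ
  u ≐ t = ι (u Fin.≟ t)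

  ≐-refl : ∀ {u} → u ≐ u ≡ 1
  ≐-refl {u} = ι-yes (u Fin.≟ u) refl

  ≐-≢ : ∀ {u t} → u ≢ t → u ≐ t ≡ 0
  ≐-≢ {u} {t} = ι-no (u Fin.≟ t)

  inc : Vertex → Edge → ℕ
  inc t f = proj₁ (ends f) ≐ t + proj₂ (ends f) ≐ t

  degree : Vertex → ℕ
  degree t = sum (inc t)

  joins-sym : ∀ {f u v} → Joins G f u v → Joins G f v u
  joins-sym (inj₁ eq) = inj₂ eq
  joins-sym (inj₂ eq) = inj₁ eq

  joins-≢ : ∀ {f u v} → Joins G f u v → u ≢ v
  joins-≢ {f} (inj₁ eq) refl = loopless f (trans (cong proj₁ eq) (sym (cong proj₂ eq)))
  joins-≢ {f} (inj₂ eq) refl = loopless f (trans (cong proj₁ eq) (sym (cong proj₂ eq)))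

  joins-ends : ∀ {f u v x y} → Joins G f u v → Joins G f x y → (u ≡ x × v ≡ y) ⊎ (u ≡ y × v ≡ x)
  joins-ends (inj₁ p) (inj₁ q) = let eq = trans (sym p) q in inj₁ (cong proj₁ eq , cong proj₂ eq)
  joins-ends (inj₁ p) (inj₂ q) = let eq = trans (sym p) q in inj₂ (cong proj₁ eq , cong proj₂ eq)
  joins-ends (inj₂ p) (inj₁ q) = let eq = trans (sym p) q in inj₂ (cong proj₂ eq , cong proj₁ eq)
  joins-ends (inj₂ p) (inj₂ q) = let eq = trans (sym p) q in inj₁ (cong proj₂ eq , cong proj₁ eq)

  inc-joins : ∀ {f u v} → Joins G f u v → ∀ t → inc t f ≡ u ≐ t + v ≐ t
  inc-joins (inj₁ eq) t = cong (λ e → proj₁ e ≐ t + proj₂ e ≐ t) eq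
  inc-joins {u = u} {v} (inj₂ eq) t = trans (cong (λ e → proj₁ e ≐ t + proj₂ e ≐ t) eq) (+-comm (v ≐ t) (u ≐ t))

  inc-joins₁ : ∀ {f u v} → Joins G f u v → inc u f ≡ 1
  inc-joins₁ {f} {u} {v} j = trans (inc-joins j u) (cong₂ _+_ ≐-refl (≐-≢ (joins-≢ j ∘ sym)))

  incident⇒inc≥1 : ∀ {t f} → Incident G t f → 1 ≤ inc t f
  incident⇒inc≥1 {t} {f} (inj₁ eq) = ≤-trans (≤-reflexive (sym (ι-yes (proj₁ (ends f) Fin.≟ t) eq))) (m≤m+n _ _)
  incident⇒inc≥1 {t} {f} (inj₂ eq) = ≤-trans (≤-reflexive (sym (ι-yes (proj₂ (ends f) Fin.≟ t) eq))) (m≤n+m _ _)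

  inc≤incident : ∀ t f → inc t f ≤ ι (incident? G t f)
  inc≤incident t f with proj₁ (ends f) Fin.≟ t | proj₂ (ends f) Fin.≟ t
  ... | yes p | yes q = ⊥-elim (loopless f (trans p (sym q)))
  ... | yes _ | no _  = ≤-refl
  ... | no _  | yes _ = ≤-refl
  ... | no _  | no _  = z≤n

  degree≤Δ : ∀ t → degree t ≤ Δ G
  degree≤Δ t = begin
    degree t                              ≤⟨ sum-mono (inc≤incident t) ⟩
    sum (λ f → ι (incident? G t f))       ≡⟨ length-filter-tabulate (incident? G t) (λ f → f) ⟨
    degreeIn G (allFin size) t            ≤⟨ ListAll.lookup (ListAll.map⁻ (xs≤max 0 (List.map (degreeIn G (allFin size)) (allFin order)))) (∈-allFin t) ⟩
    Δ G                                   ∎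
    where open ≤-Reasoning

  inc>0⇒joins : ∀ {t f} → inc t f > 0 → ∃ λ v → Joins G f t v
  inc>0⇒joins {t} {f} pos with proj₁ (ends f) Fin.≟ t | proj₂ (ends f) Fin.≟ t
  ... | yes refl | _        = proj₂ (ends f) , inj₁ refl
  ... | no _     | yes refl = proj₁ (ends f) , inj₂ refl
  ... | no _     | no _     = ⊥-elim (<-irrefl refl pos)

  -- Simple paths and odd cycles along a relation

  module _ (A : Edge → Vertex → Vertex → Set) where

    data Path : ∀ {n} → Vertex → Vertex → Vec Vertex (suc n) → Vec Edge n → Set where
      []  : ∀ {u} → Path u u (u ∷ []) []
      _∷_ : ∀ {n f u t v} {vs : Vec Vertex (suc n)} {es} → A f u t → Path t v vs es → Path u v (u ∷ vs) (f ∷ es)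

    Linked : Vertex → Vertex → Set
    Linked = Star λ s t → ∃ λ f → A f s t

    record SimplePath (u v : Vertex) (p : Parity) : Set where
      field
        {len} : ℕ
        {vs}  : Vec Vertex (suc len)
        {es}  : Vec Edge len
        path  : Path u v vs es
        uniq  : Unique vs
        par   : parity len ≡ p

    record OddCycle : Set where
      field
        {len}  : ℕ
        vs     : Vec Vertex len
        es     : Vec Edge len
        odd    : Odd len
        cycle  : IsCycle G vs es
        arc    : ∀ i → A (lookup es i) (lookup vs i) (lookup vs (next i))
        linked : ∀ i j → Linked (lookup vs i) (lookup vs j)

    record Split (u x v : Vertex) {n : ℕ} (vs : Vec Vertex (suc n)) : Set₁ where
      field
        {n₁ n₂} : ℕ
        {vs₁}   : Vec Vertex (suc n₁)
        {vs₂}   : Vec Vertex (suc n₂)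
        {es₁}   : Vec Edge n₁
        {es₂}   : Vec Edge n₂
        path₁   : Path u x vs₁ es₁
        path₂   : Path x v vs₂ es₂
        uniq₁   : Unique vs₁
        uniq₂   : Unique vs₂
        -- A vertex avoiding `vs` avoids the first part too; this keeps that part simple when it is
        -- lengthened at the front.
        all₁    : ∀ {P : Vertex → Set} → All P vs → All P vs₁
        lengths : n₁ + n₂ ≡ n

    split : ∀ {n u v} {vs : Vec Vertex (suc n)} {es} → Path u v vs es → Unique vs → ∀ x → All (x ≢_) vs ⊎ Split u x v vs
    split {u = u} p uniq x with x Fin.≟ u
    split [] uniq x | yes refl = inj₂ record
      { path₁ = [] ; path₂ = [] ; uniq₁ = [] ∷ [] ; uniq₂ = [] ∷ [] ; all₁ = λ all → all ; lengths = refl }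
    split (a ∷ p) uniq x | yes refl = inj₂ record
      { path₁ = [] ; path₂ = a ∷ p ; uniq₁ = [] ∷ [] ; uniq₂ = uniq ; all₁ = λ { (Px ∷ _) → Px ∷ [] } ; lengths = refl }
    split [] uniq x | no x≢u = inj₁ (x≢u ∷ [])
    split (a ∷ p) (u∉ ∷ uniq) x | no x≢u with split p uniq x
    ... | inj₁ x∉ = inj₁ (x≢u ∷ x∉)
    ... | inj₂ sp = inj₂ record
      { path₁ = a ∷ path₁ ; path₂ = path₂ ; uniq₁ = all₁ u∉ ∷ uniq₁ ; uniq₂ = uniq₂
      ; all₁ = λ { (Px ∷ all) → Px ∷ all₁ all } ; lengths = cong suc lengths }
      where open Split sp

    path-head : ∀ {n u v} {vs : Vec Vertex (suc n)} {es} → Path u v vs es → lookup vs zero ≡ u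
    path-head []      = refl
    path-head (_ ∷ _) = refl

    path-last : ∀ {n u v} {vs : Vec Vertex (suc n)} {es} → Path u v vs es → lookup vs (fromℕ n) ≡ v
    path-last []      = refl
    path-last (_ ∷ p) = path-last p

    path-step : ∀ {n u v} {vs : Vec Vertex (suc n)} {es} → Path u v vs es → ∀ i → A (lookup es i) (lookup vs (inject₁ i)) (lookup vs (suc i))
    path-step (a ∷ p) zero    = subst (A _ _) (sym (path-head p)) a
    path-step (a ∷ p) (suc i) = path-step p i

    linked-from : ∀ {n u v} {vs : Vec Vertex (suc n)} {es} → Path u v vs es → ∀ i → Linked u (lookup vs i)
    linked-from []      zero    = Star.ε
    linked-from (_ ∷ _) zero    = Star.ε
    linked-from (a ∷ p) (suc i) = (_ , a) ◅ linked-from p i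

    linked-to : ∀ {n u v} {vs : Vec Vertex (suc n)} {es} → Path u v vs es → ∀ i → Linked (lookup vs i) v
    linked-to []      zero    = Star.ε
    linked-to (a ∷ p) zero    = (_ , a) ◅ subst (λ t → Linked t _) (path-head p) (linked-to p zero)
    linked-to (a ∷ p) (suc i) = linked-to p i

    module _ (A⇒joins : ∀ {f s t} → A f s t → Joins G f s t) where

      -- Paths need not record that their edges are distinct: an edge used at two positions has the
      -- same two ends there, either in the same order, against the distinctness of the vertices, or
      -- reversed, against `next-next-fixed`.
      close : ∀ {n f u v} {vs : Vec Vertex (suc n)} {es} → A f v u → Path u v vs es → Unique vs → parity n ≡ 0ℙ → OddCycle
      close {n} {f} {u} {v} {vs} {es} a p uniq even = record
        { vs = vs ; es = es ∷ʳ f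
        ; odd = even⇒odd-suc even
        ; cycle = uniq , subst Unique (tabulate∘lookup (es ∷ʳ f)) (tabulate⁺ (edge-injective _ _)) , A⇒joins ∘ step
        ; arc = step
        -- Going on to the end, over the closing arc and then from the start to `j` works for every
        -- order of `i` and `j`.
        ; linked = λ i j → linked-to p i ◅◅ (_ , a) ◅ linked-from p j
        }
        where
        step : ∀ i → A (lookup (es ∷ʳ f) i) (lookup vs i) (lookup vs (next i))
        step i with view i
        ... | ‵fromℕ = subst₂ (λ e t → A e (lookup vs (fromℕ n)) t) (sym (lookup-∷ʳ-fromℕ es)) (sym (trans (cong (lookup vs) (next-fromℕ n)) (path-head p)))
                         (subst (λ t → A f t u) (sym (path-last p)) a)
        ... | ‵inject₁ j = subst₂ (λ e t → A e (lookup vs (inject₁ j)) t) (sym (lookup-∷ʳ-inject₁ es j)) (sym (cong (lookup vs) (next-inject₁ j))) (path-step p j)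
        edge-injective : ∀ i j → lookup (es ∷ʳ f) i ≡ lookup (es ∷ʳ f) j → i ≡ j
        edge-injective i j eq with joins-ends (A⇒joins (step i)) (subst (λ e → Joins G e _ _) (sym eq) (A⇒joins (step j)))
        ... | inj₁ (vᵢ≡vⱼ , _) = lookup-injective uniq i j vᵢ≡vⱼ
        ... | inj₂ (vᵢ≡vⱼ₊₁ , vᵢ₊₁≡vⱼ) with lookup-injective uniq i (next j) vᵢ≡vⱼ₊₁ | lookup-injective uniq (next i) j vᵢ₊₁≡vⱼ
        ...   | i≡ | refl = next-next-fixed even i (sym i≡) (next i)

      -- If u already lies on the path, the part of the path before u together with f is a cycle,
      -- which is removed when it is even.
      extend : ∀ {f u t v p} → A f u t → OddCycle ⊎ SimplePath t v p → OddCycle ⊎ SimplePath u v (p ⁻¹)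
      extend a (inj₁ cyc) = inj₁ cyc
      extend {u = u} {v = v} {p} a (inj₂ sp) with split path uniq u
        where open SimplePath sp
      ... | inj₁ u∉ = inj₂ record { path = a ∷ path ; uniq = u∉ ∷ uniq ; par = trans (parity-suc len) (cong _⁻¹ par) }
        where open SimplePath sp
      ... | inj₂ s = cut (parity n₁) refl
        where
        open SimplePath sp
        open Split s
        cut : ∀ q → parity n₁ ≡ q → OddCycle ⊎ SimplePath u v (p ⁻¹)
        cut 0ℙ even = inj₁ (close a path₁ uniq₁ even)
        cut 1ℙ odd  = inj₂ record { path = path₂ ; uniq = uniq₂ ; par = begin
          parity n₂                       ≡⟨ ⁻¹-involutive (parity n₂) ⟨
          (1ℙ +ℙ parity n₂) ⁻¹            ≡⟨ cong (λ q → (q +ℙ parity n₂) ⁻¹) odd ⟨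
          (parity n₁ +ℙ parity n₂) ⁻¹     ≡⟨ cong _⁻¹ (+-homo-+ n₁ n₂) ⟨
          parity (n₁ + n₂) ⁻¹             ≡⟨ cong (λ l → parity l ⁻¹) lengths ⟩
          parity len ⁻¹                   ≡⟨ cong _⁻¹ par ⟩
          p ⁻¹                            ∎ }
          where open ≡-Reasoning

      -- With an edge, such a path would repeat its first vertex as its last. This excludes the
      -- second outcome of `extend` for a closed trail of odd length.
      closed-simplePath-even : ∀ {u} → ¬ SimplePath u u 1ℙ
      closed-simplePath-even sp with path | uniq | par
        where open SimplePath sp
      ... | []    | _       | ()
      ... | a ∷ p | u∉ ∷ _  | _ = All.lookup⁺ u∉ (fromℕ _) (sym (path-last p))

  -- Partial colourings and alternating trails

  module _ {k : ℕ} where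

    Colour : Set
    Colour = Fin (suc k)

    -- Colourings are partial: colour zero marks the uncoloured edges.
    Colouring : Set
    Colouring = Edge → Colour

    pattern ∅ = zero

    deg : Colouring → Colour → Vertex → ℕ
    deg c γ t = count (inc t) c γ

    size-of : Colouring → Colour → ℕ
    size-of = count (λ _ → 1)

    deg-gain : ∀ c {f γ u v} → Joins G f u v → c f ≢ γ → ∀ t → deg (c [ f ≔ γ ]) γ t ≡ deg c γ t + (u ≐ t + v ≐ t)
    deg-gain c {f} {γ} j cf≢γ t = trans (count-gain (inc t) c cf≢γ) (cong (deg c γ t +_) (inc-joins j t))

    deg-loss : ∀ c {f x γ u v} → Joins G f u v → c f ≡ γ → x ≢ γ → ∀ t → deg (c [ f ≔ x ]) γ t + (u ≐ t + v ≐ t) ≡ deg c γ t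
    deg-loss c {f} {x} {γ} j cf≡γ x≢γ t = trans (cong (deg (c [ f ≔ x ]) γ t +_) (sym (inc-joins j t))) (count-loss (inc t) c cf≡γ x≢γ)

    -- Any set of edges of these two colours may be interchanged, not just a whole component. All
    -- other classes stay fixed, including the uncoloured edges when neither colour is `∅`.
    Swapped : Colour → Colour → Colouring → Colouring → Set
    Swapped δ γ c c′ = ∀ g → c′ g ≡ c g ⊎ (c g ≡ δ × c′ g ≡ γ) ⊎ (c g ≡ γ × c′ g ≡ δ)

    swapped-fixes : ∀ {δ γ c c′} → Swapped δ γ c c′ → ∀ {g ε} → ε ≢ δ → ε ≢ γ → c g ≡ ε → c′ g ≡ ε
    swapped-fixes sw {g} ε≢δ ε≢γ refl with sw g
    ... | inj₁ eq              = eq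
    ... | inj₂ (inj₁ (eq , _)) = ⊥-elim (ε≢δ eq)
    ... | inj₂ (inj₂ (eq , _)) = ⊥-elim (ε≢γ eq)

    swapped-reflects : ∀ {δ γ c c′} → Swapped δ γ c c′ → ∀ {g ε} → ε ≢ δ → ε ≢ γ → c′ g ≡ ε → c g ≡ ε
    swapped-reflects sw {g} ε≢δ ε≢γ refl with sw g
    ... | inj₁ eq              = sym eq
    ... | inj₂ (inj₁ (_ , eq)) = ⊥-elim (ε≢γ eq)
    ... | inj₂ (inj₂ (_ , eq)) = ⊥-elim (ε≢δ eq)

    swapped-count : ∀ {δ γ c c′} → Swapped δ γ c c′ → ∀ w {ε} → ε ≢ δ → ε ≢ γ → count w c′ ε ≡ count w c ε
    swapped-count sw w ε≢δ ε≢γ = count-cong w (λ _ → swapped-reflects sw ε≢δ ε≢γ) (λ _ → swapped-fixes sw ε≢δ ε≢γ)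

    -- The effect of interchanging δ and γ along an alternating trail that leaves u on a δ-edge and gets
    -- stuck at z, which it enters on a δ-edge (lose) or on a γ-edge (gain).
    data TrailSwap (c c′ : Colouring) (δ γ : Colour) (u z : Vertex) : Set where
      -- If the trail closes up at `u`, both of its ends turn a δ-edge into a γ-edge there, so the
      -- excess of δ must be at least 2; hence the summand `u ≐ z`.
      lose : deg c γ z + 1 + u ≐ z ≤ deg c δ z →
             (∀ t → deg c′ δ t + (u ≐ t + z ≐ t) ≡ deg c δ t) →
             (∀ t → deg c′ γ t ≡ deg c γ t + (u ≐ t + z ≐ t)) →
             TrailSwap c c′ δ γ u z
      gain : deg c δ z + 1 ≤ deg c γ z →
             (∀ t → deg c′ δ t + u ≐ t ≡ deg c δ t + z ≐ t) →
             (∀ t → deg c′ γ t + z ≐ t ≡ deg c γ t + u ≐ t) →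
             TrailSwap c c′ δ γ u z

    -- The first edge of the trail is removed (made uncoloured) before the rest of the trail is swapped.
    trailSwap : ∀ n c {δ γ u} → δ ≢ ∅ → γ ≢ ∅ → δ ≢ γ → size-of c δ + size-of c γ ≤ n → deg c γ u < deg c δ u →
                ∃ λ c′ → ∃ λ z → Swapped δ γ c c′ × TrailSwap c c′ δ γ u z
    trailSwap n c {δ} {γ} {u} δ≢∅ γ≢∅ δ≢γ size≤n γ<δ with count≡0∨edge (inc u) c δ
    ... | inj₁ ≡0 = ⊥-elim (n≮0 (subst (deg c γ u <_) ≡0 γ<δ))
    ... | inj₂ (g , inc>0 , cg≡δ) with inc>0⇒joins inc>0
    ...   | u′ , j with deg c γ u′ <? deg c δ u′
    -- The trail may stop at `u′`: even with one more γ-edge, `u′` has no more of them than it had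
    -- δ-edges.
    ...     | yes γ<δ′ = c [ g ≔ γ ] , u′ , swapped , lose enough (deg-loss c j cg≡δ (δ≢γ ∘ sym)) (deg-gain c j λ cg≡γ → δ≢γ (trans (sym cg≡δ) cg≡γ))
      where
      swapped : Swapped δ γ c (c [ g ≔ γ ])
      swapped h with h Fin.≟ g
      ... | yes refl = inj₂ (inj₁ (cg≡δ , refl))
      ... | no _     = inj₁ refl
      enough : deg c γ u′ + 1 + u ≐ u′ ≤ deg c δ u′
      enough = subst (_≤ deg c δ u′) (sym (trans (cong (deg c γ u′ + 1 +_) (≐-≢ (joins-≢ j))) (trans (+-identityʳ _) (+-comm _ 1)))) γ<δ′
    trailSwap zero c {δ} {γ} δ≢∅ γ≢∅ δ≢γ size≤n γ<δ | inj₂ (g , _ , cg≡δ) | _ | no _ =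
      ⊥-elim (n≮0 (≤-trans (subst (_≤ size-of c δ + size-of c γ) (+-comm _ 1)
        (≤-trans (≤-reflexive (count-loss (λ _ → 1) c cg≡δ (δ≢∅ ∘ sym))) (m≤m+n _ _))) size≤n))
    -- Here `u′` has at least as many γ- as δ-edges. Removing `g` makes the inequality strict, so
    -- the trail continues from `u′` with the two colours exchanged.
    trailSwap (suc n) c {δ} {γ} {u} δ≢∅ γ≢∅ δ≢γ size≤n γ<δ | inj₂ (g , _ , cg≡δ) | u′ , j | no γ≮δ′
      with trailSwap n (c [ g ≔ ∅ ]) {γ} {δ} {u′} γ≢∅ δ≢∅ (δ≢γ ∘ sym) size′≤n δ<γ′
      where
      cg≢γ : c g ≢ γ
      cg≢γ cg≡γ = δ≢γ (trans (sym cg≡δ) cg≡γ)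
      size′≤n : size-of (c [ g ≔ ∅ ]) γ + size-of (c [ g ≔ ∅ ]) δ ≤ n
      size′≤n = +-cancelʳ-≤ 1 _ _ (begin
        (size-of (c [ g ≔ ∅ ]) γ + size-of (c [ g ≔ ∅ ]) δ) + 1  ≡⟨ +-assoc (size-of (c [ g ≔ ∅ ]) γ) _ 1 ⟩
        size-of (c [ g ≔ ∅ ]) γ + (size-of (c [ g ≔ ∅ ]) δ + 1)  ≡⟨ cong₂ _+_ (count-other (λ _ → 1) c cg≢γ (γ≢∅ ∘ sym)) (count-loss (λ _ → 1) c cg≡δ (δ≢∅ ∘ sym)) ⟩
        size-of c γ + size-of c δ                                ≡⟨ +-comm (size-of c γ) _ ⟩
        size-of c δ + size-of c γ                                ≤⟨ size≤n ⟩
        suc n                                                    ≡⟨ +-comm 1 n ⟩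
        n + 1                                                    ∎)
        where open ≤-Reasoning
      δ<γ′ : deg (c [ g ≔ ∅ ]) δ u′ < deg (c [ g ≔ ∅ ]) γ u′
      δ<γ′ = begin-strict
        deg (c [ g ≔ ∅ ]) δ u′      <⟨ n<1+n _ ⟩
        1 + deg (c [ g ≔ ∅ ]) δ u′  ≡⟨ +-comm 1 _ ⟩
        deg (c [ g ≔ ∅ ]) δ u′ + 1  ≡⟨ cong (deg (c [ g ≔ ∅ ]) δ u′ +_) (sym (inc-joins₁ (joins-sym j))) ⟩
        deg (c [ g ≔ ∅ ]) δ u′ + inc u′ g  ≡⟨ count-loss (inc u′) c cg≡δ (δ≢∅ ∘ sym) ⟩
        deg c δ u′                  ≤⟨ ≮⇒≥ γ≮δ′ ⟩
        deg c γ u′                  ≡⟨ count-other (inc u′) c cg≢γ (γ≢∅ ∘ sym) ⟨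
        deg (c [ g ≔ ∅ ]) γ u′      ∎
        where open ≤-Reasoning
    ... | c₁′ , z , sw , out = c₁′ [ g ≔ γ ] , z , swapped , result out
      where
      c₁ = c [ g ≔ ∅ ]
      c′ = c₁′ [ g ≔ γ ]
      c₁′g≡∅ : c₁′ g ≡ ∅
      c₁′g≡∅ = swapped-fixes sw (γ≢∅ ∘ sym) (δ≢∅ ∘ sym) (≔-here c g ∅)
      swapped : Swapped δ γ c c′
      swapped h with h Fin.≟ g | sw h
      ... | yes refl | _ = inj₂ (inj₁ (cg≡δ , refl))
      ... | no h≢g | inj₁ eq                 = inj₁ eq
      ... | no h≢g | inj₂ (inj₁ (eq₁ , eq₂)) = inj₂ (inj₂ (eq₁ , eq₂))
      ... | no h≢g | inj₂ (inj₂ (eq₁ , eq₂)) = inj₂ (inj₁ (eq₁ , eq₂))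
      γ-gain : ∀ t → deg c′ γ t ≡ deg c₁′ γ t + (u ≐ t + u′ ≐ t)
      γ-gain = deg-gain c₁′ j λ eq → γ≢∅ (trans (sym eq) c₁′g≡∅)
      δ-same : ∀ t → deg c′ δ t ≡ deg c₁′ δ t
      δ-same t = count-other (inc t) c₁′ (λ eq → δ≢∅ (trans (sym eq) c₁′g≡∅)) (δ≢γ ∘ sym)
      δ-loss : ∀ t → deg c₁ δ t + (u ≐ t + u′ ≐ t) ≡ deg c δ t
      δ-loss = deg-loss c j cg≡δ (δ≢∅ ∘ sym)
      γ-same : ∀ t → deg c₁ γ t ≡ deg c γ t
      γ-same t = count-other (inc t) c (λ cg≡γ → δ≢γ (trans (sym cg≡δ) cg≡γ)) (γ≢∅ ∘ sym)
      open ≡-Reasoning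
      result : TrailSwap c₁ c₁′ γ δ u′ z → TrailSwap c c′ δ γ u z
      -- The recursive call has the colours exchanged, so its `lose` is a `gain` here, and
      -- conversely.
      result (lose enough γ-eq δ-eq) = gain enough′
        (λ t → begin
          deg c′ δ t + u ≐ t                              ≡⟨ cong (_+ u ≐ t) (trans (δ-same t) (δ-eq t)) ⟩
          deg c₁ δ t + (u′ ≐ t + z ≐ t) + u ≐ t           ≡⟨ rearrange (deg c₁ δ t) (u′ ≐ t) (z ≐ t) (u ≐ t) ⟩
          deg c₁ δ t + (u ≐ t + u′ ≐ t) + z ≐ t           ≡⟨ cong (_+ z ≐ t) (δ-loss t) ⟩
          deg c δ t + z ≐ t                               ∎)
        (λ t → begin
          deg c′ γ t + z ≐ t                              ≡⟨ cong (_+ z ≐ t) (γ-gain t) ⟩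
          deg c₁′ γ t + (u ≐ t + u′ ≐ t) + z ≐ t          ≡⟨ rearrange′ (deg c₁′ γ t) (u ≐ t) (u′ ≐ t) (z ≐ t) ⟩
          deg c₁′ γ t + (u′ ≐ t + z ≐ t) + u ≐ t          ≡⟨ cong (_+ u ≐ t) (trans (γ-eq t) (γ-same t)) ⟩
          deg c γ t + u ≐ t                               ∎)
        where
        rearrange : ∀ a b c d → a + (b + c) + d ≡ a + (d + b) + c
        rearrange = solve-∀
        rearrange′ : ∀ a b c d → a + (b + c) + d ≡ a + (c + d) + b
        rearrange′ = solve-∀
        rearrange″ : ∀ a b c → a + (b + c) + 1 ≡ a + 1 + c + b
        rearrange″ = solve-∀
        enough″ : deg c δ z + 1 ≤ deg c γ z + u ≐ z
        enough″ = subst₂ _≤_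
          (trans (sym (rearrange″ (deg c₁ δ z) (u ≐ z) (u′ ≐ z))) (cong (_+ 1) (δ-loss z)))
          (cong (_+ u ≐ z) (γ-same z))
          (+-monoˡ-≤ (u ≐ z) enough)
        enough′ : deg c δ z + 1 ≤ deg c γ z
        enough′ with u Fin.≟ z
        -- The end cannot be `u`: removing `g` takes just one δ-edge from `u`, too little to reverse
        -- the strict excess of δ there.
        ... | yes refl = ⊥-elim (<⇒≱ γ<δ (+-cancelʳ-≤ 1 _ _ (subst (λ x → deg c δ u + 1 ≤ deg c γ u + x) (≐-refl {u}) enough″)))
        ... | no u≢z   = subst (deg c δ z + 1 ≤_) (trans (cong (deg c γ z +_) (≐-≢ u≢z)) (+-identityʳ _)) enough″
      result (gain enough γ-eq δ-eq) = lose
        (≤-trans (+-monoˡ-≤ (u ≐ z) (subst (λ x → x + 1 ≤ deg c₁ δ z) (γ-same z) enough))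
          (≤-trans (+-monoʳ-≤ (deg c₁ δ z) (m≤m+n _ _)) (≤-reflexive (δ-loss z))))
        (λ t → begin
          deg c′ δ t + (u ≐ t + z ≐ t)     ≡⟨ cong (_+ (u ≐ t + z ≐ t)) (δ-same t) ⟩
          deg c₁′ δ t + (u ≐ t + z ≐ t)    ≡⟨ rearrange (deg c₁′ δ t) (u ≐ t) (z ≐ t) ⟩
          deg c₁′ δ t + z ≐ t + u ≐ t      ≡⟨ cong (_+ u ≐ t) (δ-eq t) ⟩
          deg c₁ δ t + u′ ≐ t + u ≐ t      ≡⟨ rearrange (deg c₁ δ t) (u ≐ t) (u′ ≐ t) ⟨
          deg c₁ δ t + (u ≐ t + u′ ≐ t)    ≡⟨ δ-loss t ⟩
          deg c δ t                        ∎)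
        (λ t → begin
          deg c′ γ t                       ≡⟨ γ-gain t ⟩
          deg c₁′ γ t + (u ≐ t + u′ ≐ t)   ≡⟨ rearrange (deg c₁′ γ t) (u ≐ t) (u′ ≐ t) ⟩
          deg c₁′ γ t + u′ ≐ t + u ≐ t     ≡⟨ cong (_+ u ≐ t) (γ-eq t) ⟩
          deg c₁ γ t + z ≐ t + u ≐ t       ≡⟨ rearrange (deg c₁ γ t) (u ≐ t) (z ≐ t) ⟨
          deg c₁ γ t + (u ≐ t + z ≐ t)     ≡⟨ cong (_+ (u ≐ t + z ≐ t)) (γ-same t) ⟩
          deg c γ t + (u ≐ t + z ≐ t)      ∎)
        where
        rearrange : ∀ a b c → a + (b + c) ≡ a + c + b
        rearrange = solve-∀

    -- Colourings that cannot be improved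

    module _ (d : ℕ) where

      Valid : Colouring → Set
      Valid c = ∀ {γ} → γ ≢ ∅ → ∀ t → deg c γ t ≤ d

      Misses : Colouring → Vertex → Colour → Set
      Misses c t γ = deg c γ t < d

      -- Minimality enters as the hypothesis `stuck`, so that no minimum has to be chosen: a `Good`
      -- colouring has one uncoloured edge more than `stuck` forbids.
      module Stuck (D N : ℕ) (D>0 : D > 0) (degree-bound : ∀ t → degree t + D ≤ k * d)
                   (stuck : ∀ c → Valid c → size-of c ∅ ≤ N → ⊥) where

        Good : Colouring → Set
        Good c = Valid c × size-of c ∅ ≡ suc N

        no-common-miss : ∀ {c f u v γ} → Good c → c f ≡ ∅ → Joins G f u v → γ ≢ ∅ → Misses c u γ → Misses c v γ → ⊥
        no-common-miss {c} {f} {u} {v} {γ} (valid , size) cf≡∅ j γ≢∅ u-misses v-misses = stuck (c [ f ≔ γ ]) valid′ size′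
          where
          open ≤-Reasoning
          cf≢ : ∀ {ε} → ε ≢ ∅ → c f ≢ ε
          cf≢ ε≢∅ eq = ε≢∅ (trans (sym eq) cf≡∅)
          size′ : size-of (c [ f ≔ γ ]) ∅ ≤ N
          size′ = ≤-reflexive (suc-injective (trans (+-comm 1 _) (trans (count-loss (λ _ → 1) c cf≡∅ γ≢∅) size)))
          γ-bound : ∀ t → deg c γ t + (u ≐ t + v ≐ t) ≤ d
          γ-bound t with u Fin.≟ t | v Fin.≟ t
          ... | yes refl | yes refl = ⊥-elim (joins-≢ j refl)
          ... | yes refl | no _     = subst (_≤ d) (+-comm 1 _) u-misses
          ... | no _     | yes refl = subst (_≤ d) (+-comm 1 _) v-misses
          ... | no _     | no _     = subst (_≤ d) (sym (+-identityʳ _)) (valid γ≢∅ t)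
          valid′ : Valid (c [ f ≔ γ ])
          valid′ {ε} ε≢∅ t with γ Fin.≟ ε
          ... | yes refl = subst (_≤ d) (sym (deg-gain c j (cf≢ γ≢∅) t)) (γ-bound t)
          ... | no γ≢ε   = subst (_≤ d) (sym (count-other (inc t) c (cf≢ ε≢∅) γ≢ε)) (valid ε≢∅ t)

        colour-sum : ∀ c t → deg c ∅ t + sum (λ i → deg c (suc i) t) ≡ degree t
        colour-sum c t = count-total (inc t) c

        some-miss : ∀ c t → ∃ λ γ → γ ≢ ∅ × Misses c t γ
        some-miss c t with Fin.any? (λ i → deg c (suc i) t <? d)
        ... | yes (i , miss) = suc i , (λ ()) , miss
        ... | no none = ⊥-elim (<⇒≱ D>0 (+-cancelˡ-≤ (degree t) D 0 (begin
          degree t + D                                   ≤⟨ degree-bound t ⟩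
          k * d                                          ≡⟨ sum-const k d ⟨
          sum {k} (λ _ → d)                              ≤⟨ sum-mono (λ i → ≮⇒≥ λ miss → none (i , miss)) ⟩
          sum (λ i → deg c (suc i) t)                    ≤⟨ m≤n+m _ _ ⟩
          deg c ∅ t + sum (λ i → deg c (suc i) t)        ≡⟨ colour-sum c t ⟩
          degree t                                       ≡⟨ +-identityʳ _ ⟨
          degree t + 0                                   ∎)))
          where open ≤-Reasoning

        -- `at-end` pairs a colour missed after the change with a comparison of degrees before it.
        -- In each use, one alternative is refuted in the new colouring and the other in the old
        -- one.
        record KempeChange (c : Colouring) (δ γ : Colour) (w : Vertex) : Set where
          field
            c⁺       : Colouring
            z        : Vertex
            good     : Good c⁺
            swapped  : Swapped δ γ c c⁺
            δ-drop   : deg c⁺ δ w < deg c δ w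
            γ-rise   : w ≢ z → deg c⁺ γ w ≡ suc (deg c γ w)
            same     : ∀ {t} → w ≢ t → z ≢ t → deg c⁺ δ t ≡ deg c δ t × deg c⁺ γ t ≡ deg c γ t
            at-end   : ∀ {t} → z ≡ t → w ≢ t → (Misses c⁺ t δ × deg c γ t < deg c δ t) ⊎ (Misses c⁺ t γ × deg c δ t < deg c γ t)

        -- Degrees change only at `w` and `z`, and a colour that rises there reaches at most the old
        -- degree of the other colour, which is at most `d`.
        kempeChange : ∀ {c δ γ w} → Good c → δ ≢ ∅ → γ ≢ ∅ → deg c γ w < deg c δ w → KempeChange c δ γ w
        kempeChange {c} {δ} {γ} {w} (valid , size) δ≢∅ γ≢∅ γ<δ
          with trailSwap _ c δ≢∅ γ≢∅ δ≢γ ≤-refl γ<δ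
          where
          δ≢γ : δ ≢ γ
          δ≢γ refl = <-irrefl refl γ<δ
        ... | c⁺ , z , sw , lose enough δ-eq γ-eq = record
          { c⁺ = c⁺ ; z = z ; swapped = sw
          ; good = valid⁺ , trans (swapped-count sw (λ _ → 1) (δ≢∅ ∘ sym) (γ≢∅ ∘ sym)) size
          ; δ-drop = δ-drop w ≐-refl
          ; γ-rise = λ w≢z → trans (γ-eq w) (trans (cong (deg c γ w +_) (cong₂ _+_ ≐-refl (≐-≢ (w≢z ∘ sym)))) (+-comm _ 1))
          ; same = λ {t} w≢t z≢t → unchanged t (≐-≢ w≢t) (≐-≢ z≢t)
          ; at-end = λ { refl _ → inj₁ (<-≤-trans (z-drop) (valid δ≢∅ z) ,
              ≤-trans (≤-reflexive (+-comm 1 _)) (≤-trans (m≤m+n _ _) enough)) }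
          }
          where
          open ≤-Reasoning
          +-zero₂ : ∀ {a x y} → x ≡ 0 → y ≡ 0 → a + (x + y) ≡ a
          +-zero₂ refl refl = +-identityʳ _
          unchanged : ∀ t → w ≐ t ≡ 0 → z ≐ t ≡ 0 → deg c⁺ δ t ≡ deg c δ t × deg c⁺ γ t ≡ deg c γ t
          unchanged t p q = trans (sym (+-zero₂ p q)) (δ-eq t) , trans (γ-eq t) (+-zero₂ p q)
          δ-drop : ∀ t → w ≐ t ≡ 1 → deg c⁺ δ t < deg c δ t
          δ-drop t p = subst₂ _≤_ (+-comm _ 1) (δ-eq t) (+-monoʳ-≤ (deg c⁺ δ t) (≤-trans (≤-reflexive (sym p)) (m≤m+n _ _)))
          z-drop : deg c⁺ δ z < deg c δ z
          z-drop = subst₂ _≤_ (+-comm _ 1) (δ-eq z) (+-monoʳ-≤ (deg c⁺ δ z) (≤-trans (≤-reflexive (sym (≐-refl {z}))) (m≤n+m _ _)))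
          γ≤d : ∀ t → deg c⁺ γ t ≤ d
          γ≤d t with z Fin.≟ t | w Fin.≟ t
          ... | yes refl | _ = begin
            deg c⁺ γ z                     ≡⟨ γ-eq z ⟩
            deg c γ z + (w ≐ z + z ≐ z)    ≡⟨ cong (λ x → deg c γ z + (w ≐ z + x)) ≐-refl ⟩
            deg c γ z + (w ≐ z + 1)        ≡⟨ cong (deg c γ z +_) (+-comm _ 1) ⟩
            deg c γ z + (1 + w ≐ z)        ≡⟨ +-assoc (deg c γ z) 1 _ ⟨
            deg c γ z + 1 + w ≐ z          ≤⟨ enough ⟩
            deg c δ z                      ≤⟨ valid δ≢∅ z ⟩
            d                              ∎
          ... | no z≢t | yes refl = begin
            deg c⁺ γ w                     ≡⟨ γ-eq w ⟩
            deg c γ w + (w ≐ w + z ≐ w)    ≡⟨ cong (deg c γ w +_) (cong₂ _+_ ≐-refl (≐-≢ z≢t)) ⟩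
            deg c γ w + 1                  ≡⟨ +-comm _ 1 ⟩
            suc (deg c γ w)                ≤⟨ γ<δ ⟩
            deg c δ w                      ≤⟨ valid δ≢∅ w ⟩
            d                              ∎
          ... | no z≢t | no w≢t = subst (_≤ d) (sym (proj₂ (unchanged t (≐-≢ w≢t) (≐-≢ z≢t)))) (valid γ≢∅ t)
          valid⁺ : Valid c⁺
          valid⁺ {ε} ε≢∅ t with ε Fin.≟ δ | ε Fin.≟ γ
          ... | yes refl | _        = ≤-trans (m≤m+n _ _) (≤-trans (≤-reflexive (δ-eq t)) (valid δ≢∅ t))
          ... | no _     | yes refl = γ≤d t
          ... | no ε≢δ   | no ε≢γ   = subst (_≤ d) (sym (swapped-count sw (inc t) ε≢δ ε≢γ)) (valid ε≢∅ t)
        ... | c⁺ , z , sw , gain enough δ-eq γ-eq = record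
          { c⁺ = c⁺ ; z = z ; swapped = sw
          ; good = valid⁺ , trans (swapped-count sw (λ _ → 1) (δ≢∅ ∘ sym) (γ≢∅ ∘ sym)) size
          ; δ-drop = ≤-reflexive (trans (+-comm 1 _) (subst₂ _≡_ (cong (deg c⁺ δ w +_) ≐-refl) (trans (cong (deg c δ w +_) (≐-≢ z≢w)) (+-identityʳ _)) (δ-eq w)))
          ; γ-rise = λ _ → trans (subst₂ _≡_ (trans (cong (deg c⁺ γ w +_) (≐-≢ z≢w)) (+-identityʳ _)) (cong (deg c γ w +_) ≐-refl) (γ-eq w)) (+-comm _ 1)
          ; same = λ {t} w≢t z≢t → unchanged t (≐-≢ w≢t) (≐-≢ z≢t)
          ; at-end = λ { refl w≢z → inj₂ (≤-trans (≤-reflexive (trans (+-comm 1 _) (subst₂ _≡_ (cong (deg c⁺ γ z +_) ≐-refl) (trans (cong (deg c γ z +_) (≐-≢ w≢z)) (+-identityʳ _)) (γ-eq z)))) (valid γ≢∅ z) , δ<γ) }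
          }
          where
          open ≤-Reasoning
          δ<γ : deg c δ z < deg c γ z
          δ<γ = subst (_≤ deg c γ z) (+-comm _ 1) enough
          z≢w : z ≢ w
          z≢w refl = <-asym γ<δ δ<γ
          unchanged : ∀ t → w ≐ t ≡ 0 → z ≐ t ≡ 0 → deg c⁺ δ t ≡ deg c δ t × deg c⁺ γ t ≡ deg c γ t
          unchanged t p q = cancel p q (δ-eq t) , cancel q p (γ-eq t)
            where
            cancel : ∀ {a b x y} → x ≡ 0 → y ≡ 0 → a + x ≡ b + y → a ≡ b
            cancel refl refl eq = subst₂ _≡_ (+-identityʳ _) (+-identityʳ _) eq
          δ≤d : ∀ t → deg c⁺ δ t ≤ d
          δ≤d t with z Fin.≟ t
          ... | yes refl = begin
            deg c⁺ δ z                     ≤⟨ m≤m+n _ _ ⟩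
            deg c⁺ δ z + w ≐ z             ≡⟨ δ-eq z ⟩
            deg c δ z + z ≐ z              ≡⟨ cong (deg c δ z +_) ≐-refl ⟩
            deg c δ z + 1                  ≤⟨ enough ⟩
            deg c γ z                      ≤⟨ valid γ≢∅ z ⟩
            d                              ∎
          ... | no z≢t = begin
            deg c⁺ δ t                     ≤⟨ m≤m+n _ _ ⟩
            deg c⁺ δ t + w ≐ t             ≡⟨ δ-eq t ⟩
            deg c δ t + z ≐ t              ≡⟨ cong (deg c δ t +_) (≐-≢ z≢t) ⟩
            deg c δ t + 0                  ≡⟨ +-identityʳ _ ⟩
            deg c δ t                      ≤⟨ valid δ≢∅ t ⟩
            d                              ∎
          γ≤d : ∀ t → deg c⁺ γ t ≤ d
          γ≤d t with w Fin.≟ t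
          ... | yes refl = begin
            deg c⁺ γ w                     ≤⟨ m≤m+n _ _ ⟩
            deg c⁺ γ w + z ≐ w             ≡⟨ γ-eq w ⟩
            deg c γ w + w ≐ w              ≡⟨ cong (deg c γ w +_) ≐-refl ⟩
            deg c γ w + 1                  ≡⟨ +-comm _ 1 ⟩
            suc (deg c γ w)                ≤⟨ γ<δ ⟩
            deg c δ w                      ≤⟨ valid δ≢∅ w ⟩
            d                              ∎
          ... | no w≢t = begin
            deg c⁺ γ t                     ≤⟨ m≤m+n _ _ ⟩
            deg c⁺ γ t + z ≐ t             ≡⟨ γ-eq t ⟩
            deg c γ t + w ≐ t              ≡⟨ cong (deg c γ t +_) (≐-≢ w≢t) ⟩
            deg c γ t + 0                  ≡⟨ +-identityʳ _ ⟩
            deg c γ t                      ≤⟨ valid γ≢∅ t ⟩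
            d                              ∎
          valid⁺ : Valid c⁺
          valid⁺ {ε} ε≢∅ t with ε Fin.≟ δ | ε Fin.≟ γ
          ... | yes refl | _        = δ≤d t
          ... | no _     | yes refl = γ≤d t
          ... | no ε≢δ   | no ε≢γ   = subst (_≤ d) (sym (swapped-count sw (inc t) ε≢δ ε≢γ)) (valid ε≢∅ t)

        full : ∀ {c f u v γ} → Good c → c f ≡ ∅ → Joins G f u v → γ ≢ ∅ → Misses c u γ → d ≤ deg c γ v
        full good cf≡∅ j γ≢∅ miss = ≮⇒≥ (no-common-miss good cf≡∅ j γ≢∅ miss)

        -- Suppose `u` lacks two γ-edges, and let `v` miss δ. A change of δ and γ from `u` makes `u`
        -- miss δ, so it must end at `v`, or `v` would still miss δ. As `v` is full in γ, it cannot
        -- have more δ- than γ-edges, so it ends up missing γ. But `u` has gained only one γ-edge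
        -- and misses γ as well.
        deficit≤1 : ∀ {c f u v γ} → Good c → c f ≡ ∅ → Joins G f u v → γ ≢ ∅ → d ≤ suc (deg c γ u)
        deficit≤1 {c} {f} {u} {v} {γ} good cf≡∅ j γ≢∅ = ≮⇒≥ λ γ-short → contra γ-short
          where
          contra : suc (deg c γ u) < d → ⊥
          contra γ-short with some-miss c v
          ... | δ , δ≢∅ , v-misses = impossible
            where
            γ-miss : Misses c u γ
            γ-miss = <-trans (n<1+n _) γ-short
            kc : KempeChange c δ γ u
            kc = kempeChange good δ≢∅ γ≢∅ (<-≤-trans γ-miss (full good cf≡∅ (joins-sym j) δ≢∅ v-misses))
            open KempeChange kc renaming (good to good⁺)
            c⁺f≡∅ : c⁺ f ≡ ∅
            c⁺f≡∅ = swapped-fixes swapped (δ≢∅ ∘ sym) (γ≢∅ ∘ sym) cf≡∅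
            u-misses-δ : Misses c⁺ u δ
            u-misses-δ = <-≤-trans δ-drop (proj₁ good δ≢∅ u)
            impossible : ⊥
            impossible with z Fin.≟ v
            ... | no z≢v = no-common-miss good⁺ c⁺f≡∅ j δ≢∅ u-misses-δ
              (subst (_< d) (sym (proj₁ (same (joins-≢ j) z≢v))) v-misses)
            ... | yes z≡v with at-end z≡v (joins-≢ j)
            ...   | inj₁ (_ , γ<δ) = <⇒≱ (<-trans γ<δ v-misses) (full good cf≡∅ j γ≢∅ γ-miss)
            ...   | inj₂ (v-misses-γ , _) = no-common-miss good⁺ c⁺f≡∅ j γ≢∅
              (subst (_< d) (sym (γ-rise λ u≡z → joins-≢ j (trans u≡z z≡v))) γ-short) v-misses-γ

        -- Recolouring within two fixed colours

        module _ {α β : Colour} (α≢∅ : α ≢ ∅) (β≢∅ : β ≢ ∅) where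

          Rest : Colour → Set
          Rest γ = γ ≢ ∅ × γ ≢ α × γ ≢ β

          rest? : ∀ γ → Dec (Rest γ)
          rest? γ = ¬? (γ Fin.≟ ∅) ×-dec ¬? (γ Fin.≟ α) ×-dec ¬? (γ Fin.≟ β)

          infix 4 _≈_

          record _≈_ (c c′ : Colouring) : Set where
            field
              to   : ∀ {γ} → Rest γ → ∀ {g} → c g ≡ γ → c′ g ≡ γ
              from : ∀ {γ} → Rest γ → ∀ {g} → c′ g ≡ γ → c g ≡ γ

          open _≈_

          ≈-refl : ∀ {c} → c ≈ c
          ≈-refl = record { to = λ _ eq → eq ; from = λ _ eq → eq }

          ≈-sym : ∀ {c c′} → c ≈ c′ → c′ ≈ c
          ≈-sym p = record { to = from p ; from = to p }

          ≈-trans : ∀ {c c′ c″} → c ≈ c′ → c′ ≈ c″ → c ≈ c″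
          ≈-trans p q = record { to = λ r eq → to q r (to p r eq) ; from = λ r eq → from p r (from q r eq) }

          ≈-count : ∀ w {c c′ γ} → c ≈ c′ → Rest γ → count w c γ ≡ count w c′ γ
          ≈-count w p r = count-cong w (λ _ → to p r) (λ _ → from p r)

          αβ-Pair : Colour → Colour → Set
          αβ-Pair a b = (a ≡ α × b ≡ β) ⊎ (a ≡ β × b ≡ α)

          pair-sym : ∀ {a b} → αβ-Pair a b → αβ-Pair b a
          pair-sym (inj₁ (p , q)) = inj₂ (q , p)
          pair-sym (inj₂ (p , q)) = inj₁ (q , p)

          pair-≢∅ : ∀ {a b} → αβ-Pair a b → a ≢ ∅
          pair-≢∅ (inj₁ (refl , _)) = α≢∅
          pair-≢∅ (inj₂ (refl , _)) = β≢∅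

          pair-¬rest : ∀ {a b} → αβ-Pair a b → ¬ Rest a
          pair-¬rest (inj₁ (refl , _)) (_ , ≢α , _) = ≢α refl
          pair-¬rest (inj₂ (refl , _)) (_ , _ , ≢β) = ≢β refl

          pair-rest : ∀ {a b γ} → αβ-Pair a b → γ ≢ ∅ → γ ≢ a → γ ≢ b → Rest γ
          pair-rest (inj₁ (refl , refl)) γ≢∅ γ≢a γ≢b = γ≢∅ , γ≢a , γ≢b
          pair-rest (inj₂ (refl , refl)) γ≢∅ γ≢a γ≢b = γ≢∅ , γ≢b , γ≢a

          -- The edge f can be made uncoloured by recolouring c within α and β only.
          record Arc (c : Colouring) (f : Edge) (s t : Vertex) : Set where
            field
              {c′}      : Colouring
              {a b}     : Colour
              agree     : c ≈ c′
              good      : Good c′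
              pair      : αβ-Pair a b
              joins     : Joins G f s t
              uncol     : c′ f ≡ ∅
              s-misses  : Misses c′ s a
              t-misses  : Misses c′ t b

          arc-sym : ∀ {c f s t} → Arc c f s t → Arc c f t s
          arc-sym arc = record { agree = agree ; good = good ; pair = pair-sym pair ; joins = joins-sym joins ; uncol = uncol ; s-misses = t-misses ; t-misses = s-misses }
            where open Arc arc

          rebase : ∀ {c₁ c f s t} → c₁ ≈ c → Arc c f s t → Arc c₁ f s t
          rebase p arc = record { Arc arc ; agree = ≈-trans p (Arc.agree arc) }

          RestMiss : Colouring → Vertex → Colour → Set
          RestMiss c t γ = Rest γ × Misses c t γ

          restMiss? : ∀ c t γ → Dec (RestMiss c t γ)
          restMiss? c t γ = rest? γ ×-dec (deg c γ t <? d)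

          -- In `c′` the edge `f` is uncoloured, so the deficits of `s` over all `k` colours add up
          -- to at least `D + 1`. Each is at most 1, the one of `a` accounts for the extra 1, and
          -- `b` has none since `t` misses it. The remaining `D` belong to `Rest` colours, on which
          -- `c` and `c′` agree.
          rest-deficit : ∀ {c f s t} → Arc c f s t → D ≤ sum (λ i → ι (restMiss? c s (suc i)))
          rest-deficit {c} {f} {s} {t} arc = +-cancelˡ-≤ (degree s) _ _ (begin
            degree s + D                                               ≤⟨ degree-bound s ⟩
            k * d                                                      ≡⟨ sum-const k d ⟨
            sum {k} (λ _ → d)                                          ≤⟨ sum-mono pointwise ⟩
            sum (λ i → missing i + (atA i + degs i))                   ≡⟨ ∑-distrib-+ missing (λ i → atA i + degs i) ⟩
            sum missing + sum (λ i → atA i + degs i)                   ≡⟨ cong (sum missing +_) (∑-distrib-+ atA degs) ⟩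
            sum missing + (sum atA + sum degs)                         ≤⟨ +-monoʳ-≤ (sum missing) (+-monoˡ-≤ (sum degs) atA≤1) ⟩
            sum missing + (1 + sum degs)                               ≤⟨ +-monoʳ-≤ (sum missing) (+-monoˡ-≤ (sum degs) uncol≥1) ⟩
            sum missing + (deg c′ ∅ s + sum degs)                      ≡⟨ cong (sum missing +_) (colour-sum c′ s) ⟩
            sum missing + degree s                                     ≡⟨ +-comm (sum missing) _ ⟩
            degree s + sum missing                                     ∎)
            where
            open Arc arc
            open ≤-Reasoning
            missing atA degs : Fin k → ℕ
            missing i = ι (restMiss? c s (suc i))
            atA i     = ι (a Fin.≟ suc i)
            degs i    = deg c′ (suc i) s
            atA≤1 : sum atA ≤ 1
            atA≤1 = ≤-trans (m≤n+m (sum atA) (ι (a Fin.≟ zero))) (≤-reflexive (sum-≟ a))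
            uncol≥1 : 1 ≤ deg c′ ∅ s
            uncol≥1 = subst₂ _≤_ (inc-joins₁ joins) (cong (λ γ → deg c′ γ s) uncol) (count-term (inc s) c′ f)
            pointwise : ∀ i → d ≤ missing i + (atA i + degs i)
            pointwise i with restMiss? c s (suc i)
            ... | yes _ = ≤-trans (deficit≤1 good uncol joins (λ ())) (s≤s (m≤n+m _ (atA i)))
            ... | no ¬miss with a Fin.≟ suc i
            ...   | yes _ = deficit≤1 good uncol joins (λ ())
            ...   | no a≢ = ≮⇒≥ λ miss → case b Fin.≟ suc i of λ
              { (yes refl) → no-common-miss good uncol joins (λ ()) miss t-misses
              ; (no b≢)    → let r = pair-rest pair (λ ()) (a≢ ∘ sym) (b≢ ∘ sym) in
                             ¬miss (r , subst (_< d) (sym (≈-count (inc s) agree r)) miss) }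

          swapped-rest : ∀ {δ γ c c⁺} → Swapped δ γ c c⁺ → Rest δ → Rest γ → ∀ {h} → Rest (c h) → Rest (c⁺ h)
          swapped-rest sw rδ rγ {h} r with sw h
          ... | inj₁ eq              = subst Rest (sym eq) r
          ... | inj₂ (inj₁ (_ , eq)) = subst Rest (sym eq) rγ
          ... | inj₂ (inj₂ (_ , eq)) = subst Rest (sym eq) rδ

          swapped-rest⁻ : ∀ {δ γ c c⁺} → Swapped δ γ c c⁺ → Rest δ → Rest γ → ∀ {h} → Rest (c⁺ h) → Rest (c h)
          swapped-rest⁻ sw rδ rγ {h} r with sw h
          ... | inj₁ eq              = subst Rest eq r
          ... | inj₂ (inj₁ (eq , _)) = subst Rest (sym eq) rδ
          ... | inj₂ (inj₂ (eq , _)) = subst Rest (sym eq) rγ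

          -- The new witness `mix` takes the `Rest` colours from `c⁺` and everything else from `c′`.
          -- This is consistent because `c`, `c′` and `c⁺` have the same set of edges in `Rest`
          -- colours. Each class of `mix` is then a class of `c⁺` or of `c′`, whence its validity.
          transport : ∀ {c c⁺ δ γ f s t} → Good c⁺ → Swapped δ γ c c⁺ → Rest δ → Rest γ → Arc c f s t → Arc c⁺ f s t
          transport {c} {c⁺} {f = f} {s} {t} good⁺ sw rδ rγ arc = record
            { c′ = mix ; agree = record { to = rest-from ; from = rest-to } ; pair = pair ; joins = joins
            ; good = valid , trans (count-other-colours (λ _ → 1) ∅-¬rest) (proj₂ good)
            ; uncol = other-from ∅-¬rest uncol
            ; s-misses = subst (_< d) (sym (count-other-colours (inc s) (pair-¬rest pair))) s-misses
            ; t-misses = subst (_< d) (sym (count-other-colours (inc t) (pair-¬rest (pair-sym pair)))) t-misses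
            }
            where
            open Arc arc
            ∅-¬rest : ¬ Rest ∅
            ∅-¬rest (∅≢∅ , _) = ∅≢∅ refl
            mix : Colouring
            mix h with rest? (c′ h)
            ... | yes _ = c⁺ h
            ... | no _  = c′ h
            rest-to : ∀ {ε} → Rest ε → ∀ {h} → mix h ≡ ε → c⁺ h ≡ ε
            rest-to rε {h} eq with rest? (c′ h)
            ... | yes _ = eq
            ... | no ¬r = ⊥-elim (¬r (subst Rest (sym eq) rε))
            rest-from : ∀ {ε} → Rest ε → ∀ {h} → c⁺ h ≡ ε → mix h ≡ ε
            rest-from rε {h} eq with rest? (c′ h)
            ... | yes _ = eq
            ... | no ¬r = ⊥-elim (¬r (subst Rest (sym (to agree r refl)) r))
              where r = swapped-rest⁻ sw rδ rγ (subst Rest (sym eq) rε)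
            other-to : ∀ {ε} → ¬ Rest ε → ∀ {h} → mix h ≡ ε → c′ h ≡ ε
            other-to ¬rε {h} eq with rest? (c′ h)
            ... | yes r = ⊥-elim (¬rε (subst Rest eq (swapped-rest sw rδ rγ (subst Rest (sym (from agree r refl)) r))))
            ... | no _  = eq
            other-from : ∀ {ε} → ¬ Rest ε → ∀ {h} → c′ h ≡ ε → mix h ≡ ε
            other-from ¬rε {h} eq with rest? (c′ h)
            ... | yes r = ⊥-elim (¬rε (subst Rest eq r))
            ... | no _  = eq
            count-other-colours : ∀ w {ε} → ¬ Rest ε → count w mix ε ≡ count w c′ ε
            count-other-colours w ¬rε = count-cong w (λ _ → other-to ¬rε) (λ _ → other-from ¬rε)
            valid : Valid mix
            valid {ε} ε≢∅ v with rest? ε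
            ... | yes rε = subst (_≤ d) (sym (count-cong (inc v) (λ _ → rest-to rε) (λ _ → rest-from rε))) (proj₁ good⁺ ε≢∅ v)
            ... | no ¬rε = subst (_≤ d) (sym (count-other-colours (inc v) ¬rε)) (proj₁ good ε≢∅ v)

          -- If s and w miss γ, let δ be missed by the neighbour t of s on the way to w. Swapping δ and γ along
          -- the trail from w makes w miss δ as well, which brings the conflict one step closer.
          elementary : ∀ {c₀ s w} → Linked (Arc c₀) s w → ∀ {c γ} → (∀ {f s t} → Arc c₀ f s t → Arc c f s t) →
                       s ≢ w → Rest γ → Misses c s γ → Misses c w γ → ⊥
          elementary Star.ε _ s≢s _ _ _ = s≢s refl
          elementary {s = s} {w} (_◅_ {j = t} (f , arc₀) links) {c} {γ} incl s≢w rγ@(γ≢∅ , _) s-miss w-miss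
            with incl arc₀
          ... | arc with t Fin.≟ w
          ...   | yes refl = no-common-miss good uncol joins γ≢∅
                    (subst (_< d) (≈-count (inc s) agree rγ) s-miss) (subst (_< d) (≈-count (inc w) agree rγ) w-miss)
            where open Arc arc
          ...   | no t≢w with sum≡0∨term (λ i → ι (restMiss? c t (suc i)))
          ...     | inj₁ ≡0 = <⇒≱ D>0 (subst (D ≤_) ≡0 (rest-deficit (arc-sym arc)))
          ...     | inj₂ (i , pos) with restMiss? c t (suc i)
          ...       | no _ = n≮0 pos
          ...       | yes (rδ@(δ≢∅ , _) , t-miss) with deg c (suc i) w <? d
          ...         | yes w-miss-δ = elementary links incl t≢w rδ t-miss w-miss-δ
          -- The change is made in `c′` rather than in `c`: there `f` is uncoloured, so
          -- `no-common-miss` applies to `s` and `t` both before and after it.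
          ...         | no w-full = change (kempeChange good δ≢∅ γ≢∅ (<-≤-trans (miss′ rγ w-miss)
                            (subst (d ≤_) (≈-count (inc w) agree rδ) (≮⇒≥ w-full))))
            where
            open Arc arc
            δ = Fin.suc i
            miss′ : ∀ {ε v} → Rest ε → Misses c v ε → Misses c′ v ε
            miss′ {v = v} r = subst (_< d) (≈-count (inc v) agree r)
            change : KempeChange c′ δ γ w → ⊥
            change kc with z Fin.≟ s | z Fin.≟ t
              where open KempeChange kc
            ... | yes z≡s | yes z≡t = joins-≢ joins (trans (sym z≡s) z≡t)
            ... | yes z≡s | no z≢t with KempeChange.at-end kc z≡s (s≢w ∘ sym)
            ...   | inj₁ (s-miss-δ , _) = no-common-miss good⁺ c⁺f≡∅ joins δ≢∅ s-miss-δ (subst (_< d) (sym (proj₁ (same (t≢w ∘ sym) z≢t))) (miss′ rδ t-miss))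
              where
              open KempeChange kc renaming (good to good⁺)
              c⁺f≡∅ = swapped-fixes swapped (δ≢∅ ∘ sym) (γ≢∅ ∘ sym) uncol
            ...   | inj₂ (_ , δ<γ) = no-common-miss good uncol joins δ≢∅ (<-trans δ<γ (miss′ rγ s-miss)) (miss′ rδ t-miss)
            change kc | no z≢s | yes z≡t with KempeChange.at-end kc z≡t (t≢w ∘ sym)
            ...   | inj₁ (_ , γ<δ) = no-common-miss good uncol joins γ≢∅ (miss′ rγ s-miss) (<-trans γ<δ (miss′ rδ t-miss))
            ...   | inj₂ (t-miss-γ , _) = no-common-miss good⁺ c⁺f≡∅ joins γ≢∅ (subst (_< d) (sym (proj₂ (same (s≢w ∘ sym) z≢s))) (miss′ rγ s-miss)) t-miss-γ
              where
              open KempeChange kc renaming (good to good⁺)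
              c⁺f≡∅ = swapped-fixes swapped (δ≢∅ ∘ sym) (γ≢∅ ∘ sym) uncol
            -- The links remain arcs of the fixed `c₀` while the colouring changes; only the
            -- inclusion of these arcs is extended, which keeps the recursion structural.
            change kc | no z≢s | no z≢t = elementary links (transport good⁺ swapped rδ rγ ∘ rebase (≈-sym agree) ∘ incl) t≢w rδ
                (subst (_< d) (sym (proj₁ (same (t≢w ∘ sym) z≢t))) (miss′ rδ t-miss))
                (<-≤-trans δ-drop (proj₁ good δ≢∅ w))
              where open KempeChange kc renaming (good to good⁺)

          ≔-≈ : ∀ {c f x} → ¬ Rest (c f) → ¬ Rest x → c ≈ c [ f ≔ x ]
          ≔-≈ {c} {f} {x} ¬rf ¬rx = record { to = forth ; from = back }
            where
            forth : ∀ {γ} → Rest γ → ∀ {g} → c g ≡ γ → (c [ f ≔ x ]) g ≡ γ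
            forth r {g} eq with g Fin.≟ f
            ... | yes refl = ⊥-elim (¬rf (subst Rest (sym eq) r))
            ... | no _     = eq
            back : ∀ {γ} → Rest γ → ∀ {g} → (c [ f ≔ x ]) g ≡ γ → c g ≡ γ
            back r {g} eq with g Fin.≟ f
            ... | yes _ = ⊥-elim (¬rx (subst Rest (sym eq) r))
            ... | no _  = eq

          -- Shifting the uncoloured edge

          module _ (c₀ : Colouring) (y : Vertex) where

            -- Correction for the start of the trail, which is left once more than it is entered. It
            -- changes sides at every step, as `a` and `b` exchange roles.
            at-y : Parity → Vertex → ℕ
            at-y 0ℙ z = 0
            at-y 1ℙ z = y ≐ z

            -- The uncoloured edge is shifted along an αβ-alternating trail that began with an uncoloured edge
            -- leaving y. It is now f, directed from u to v; the colouring ρ keeps the colours of the edges not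
            -- yet traversed. If f is counted as having colour a, every pass of the trail through a vertex uses
            -- a and b equally often, which is the balance equation. Hence a trail that gets stuck at v has
            -- returned to y after an odd number of steps.
            oddCycle∨simplePath : ∀ n c ρ {f u v a b} p → c₀ ≈ c → Good c → αβ-Pair a b → Joins G f u v → c f ≡ ∅ →
              Misses c u a → Misses c v b → (∀ g → ρ g ≡ ∅ ⊎ ρ g ≡ c g) → size-of ρ a + size-of ρ b ≤ n →
              (∀ z → deg c a z + deg ρ b z + u ≐ z + at-y (p ⁻¹) z ≡ deg c b z + deg ρ a z + at-y p z) →
              OddCycle (Arc c₀) ⊎ SimplePath (Arc c₀) u y p
            oddCycle∨simplePath n c ρ {f} {u} {v} {a} {b} p agree good pair j uncol u-misses v-misses fresh size≤n balance
              with count≡0∨edge (inc v) ρ a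
            ... | inj₁ ≡0 = finish p balance
              where
              arc : Arc c₀ f u v
              arc = record { agree = agree ; good = good ; pair = pair ; joins = j ; uncol = uncol ; s-misses = u-misses ; t-misses = v-misses }
              at-y≢0 : ∀ p → (∀ z → deg c a z + deg ρ b z + u ≐ z + at-y (p ⁻¹) z ≡ deg c b z + deg ρ a z + at-y p z) → at-y p v ≢ 0
              at-y≢0 p balance at-y≡0 = <⇒≱ v-misses (begin
                d                                                        ≤⟨ full good uncol j (pair-≢∅ pair) u-misses ⟩
                deg c a v                                                ≤⟨ m≤m+n _ _ ⟩
                deg c a v + deg ρ b v                                    ≤⟨ m≤m+n _ _ ⟩
                deg c a v + deg ρ b v + u ≐ v                            ≤⟨ m≤m+n _ _ ⟩
                deg c a v + deg ρ b v + u ≐ v + at-y (p ⁻¹) v            ≡⟨ balance v ⟩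
                deg c b v + deg ρ a v + at-y p v                         ≡⟨ cong₂ (λ x y → deg c b v + x + y) ≡0 at-y≡0 ⟩
                deg c b v + 0 + 0                                        ≡⟨ trans (+-identityʳ _) (+-identityʳ _) ⟩
                deg c b v                                                ∎)
                where open ≤-Reasoning
              finish : ∀ p → (∀ z → deg c a z + deg ρ b z + u ≐ z + at-y (p ⁻¹) z ≡ deg c b z + deg ρ a z + at-y p z) →
                       OddCycle (Arc c₀) ⊎ SimplePath (Arc c₀) u y p
              finish 0ℙ balance = ⊥-elim (at-y≢0 0ℙ balance refl)
              finish 1ℙ balance with y Fin.≟ v
              ... | no y≢v   = ⊥-elim (at-y≢0 1ℙ balance (≐-≢ y≢v))
              ... | yes refl = extend (Arc c₀) Arc.joins arc (inj₂ record { path = [] ; uniq = [] ∷ [] ; par = refl })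
            ... | inj₂ (g , inc>0 , ρg≡a) with inc>0⇒joins inc>0
            ...   | v′ , jg = continue n size≤n
              where
              a≢∅ : a ≢ ∅
              a≢∅ = pair-≢∅ pair
              b≢∅ : b ≢ ∅
              b≢∅ = pair-≢∅ (pair-sym pair)
              a≢b : a ≢ b
              a≢b refl = no-common-miss good uncol j a≢∅ u-misses v-misses
              arc : Arc c₀ f u v
              arc = record { agree = agree ; good = good ; pair = pair ; joins = j ; uncol = uncol ; s-misses = u-misses ; t-misses = v-misses }
              cg≡a : c g ≡ a
              cg≡a with fresh g
              ... | inj₁ ρg≡∅ = ⊥-elim (a≢∅ (trans (sym ρg≡a) ρg≡∅))
              ... | inj₂ eq   = trans (sym eq) ρg≡a
              c₁ = c [ f ≔ a ]
              c′ = c₁ [ g ≔ ∅ ]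
              ρ′ = ρ [ g ≔ ∅ ]
              cf≢ : ∀ {ε} → ε ≢ ∅ → c f ≢ ε
              cf≢ ε≢∅ eq = ε≢∅ (trans (sym eq) uncol)
              c₁g≡a : c₁ g ≡ a
              c₁g≡a = trans (≔-there c a λ { refl → cf≢ a≢∅ cg≡a }) cg≡a
              -- Colour `a` moves from `g` to `f`. These share `v`, so `u` gains an a-edge, `v′`
              -- loses one and `v` is unaffected.
              a-shift : ∀ z → deg c′ a z + v′ ≐ z ≡ deg c a z + u ≐ z
              a-shift z = +-cancelʳ-≡ (v ≐ z) _ _ (begin
                deg c′ a z + v′ ≐ z + v ≐ z        ≡⟨ rearrange (deg c′ a z) (v′ ≐ z) (v ≐ z) ⟩
                deg c′ a z + (v ≐ z + v′ ≐ z)      ≡⟨ deg-loss c₁ jg c₁g≡a (a≢∅ ∘ sym) z ⟩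
                deg c₁ a z                         ≡⟨ deg-gain c j (cf≢ a≢∅) z ⟩
                deg c a z + (u ≐ z + v ≐ z)        ≡⟨ +-assoc (deg c a z) _ _ ⟨
                deg c a z + u ≐ z + v ≐ z          ∎)
                where
                open ≡-Reasoning
                rearrange : ∀ a b c → a + b + c ≡ a + (c + b)
                rearrange = solve-∀
              other-same : ∀ {ε} → ε ≢ ∅ → ε ≢ a → ∀ z → deg c′ ε z ≡ deg c ε z
              other-same ε≢∅ ε≢a z = trans
                (count-other (inc z) c₁ (λ eq → ε≢a (trans (sym eq) c₁g≡a)) (ε≢∅ ∘ sym))
                (count-other (inc z) c (cf≢ ε≢∅) (ε≢a ∘ sym))
              a-bound : ∀ z → deg c′ a z + v′ ≐ z ≤ d
              a-bound z = subst (_≤ d) (sym (a-shift z)) bound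
                where
                bound : deg c a z + u ≐ z ≤ d
                bound with u Fin.≟ z
                ... | yes refl = subst (_≤ d) (+-comm 1 _) u-misses
                ... | no _     = subst (_≤ d) (sym (+-identityʳ _)) (proj₁ good a≢∅ z)
              good′ : Good c′
              good′ = valid′ , (begin
                size-of c′ ∅       ≡⟨ count-gain (λ _ → 1) c₁ (λ eq → a≢∅ (trans (sym c₁g≡a) eq)) ⟩
                size-of c₁ ∅ + 1   ≡⟨ count-loss (λ _ → 1) c uncol a≢∅ ⟩
                size-of c ∅        ≡⟨ proj₂ good ⟩
                suc N              ∎)
                where
                open ≡-Reasoning
                valid′ : Valid c′
                valid′ {ε} ε≢∅ z with ε Fin.≟ a
                ... | yes refl = ≤-trans (m≤m+n _ _) (a-bound z)
                ... | no ε≢a   = subst (_≤ d) (sym (other-same ε≢∅ ε≢a z)) (proj₁ good ε≢∅ z)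
              ∅-¬rest : ¬ Rest ∅
              ∅-¬rest (∅≢∅ , _) = ∅≢∅ refl
              agree′ : c₀ ≈ c′
              agree′ = ≈-trans agree (≈-trans
                (≔-≈ (subst (¬_ ∘ Rest) (sym uncol) ∅-¬rest) (pair-¬rest pair))
                (≔-≈ (subst (¬_ ∘ Rest) (sym c₁g≡a) (pair-¬rest pair)) ∅-¬rest))
              fresh′ : ∀ h → ρ′ h ≡ ∅ ⊎ ρ′ h ≡ c′ h
              fresh′ h with h Fin.≟ g | h Fin.≟ f | fresh h
              ... | yes _ | _        | _       = inj₁ refl
              ... | no _  | _        | inj₁ eq = inj₁ eq
              ... | no _  | yes refl | inj₂ eq = inj₁ (trans eq uncol)
              ... | no _  | no h≢f   | inj₂ eq = inj₂ (trans eq (sym (≔-there c a h≢f)))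
              balance′ : ∀ z → deg c′ b z + deg ρ′ a z + v ≐ z + at-y (p ⁻¹ ⁻¹) z ≡ deg c′ a z + deg ρ′ b z + at-y (p ⁻¹) z
              balance′ z = +-cancelʳ-≡ (v′ ≐ z) _ _ (begin
                deg c′ b z + deg ρ′ a z + v ≐ z + at-y (p ⁻¹ ⁻¹) z + v′ ≐ z   ≡⟨ cong₂ (λ x q → x + deg ρ′ a z + v ≐ z + at-y q z + v′ ≐ z) (other-same b≢∅ (a≢b ∘ sym) z) (⁻¹-involutive p) ⟩
                deg c b z + deg ρ′ a z + v ≐ z + at-y p z + v′ ≐ z            ≡⟨ rearrange (deg c b z) (deg ρ′ a z) (v ≐ z) (at-y p z) (v′ ≐ z) ⟩
                deg c b z + (deg ρ′ a z + (v ≐ z + v′ ≐ z)) + at-y p z        ≡⟨ cong (λ x → deg c b z + x + at-y p z) (deg-loss ρ jg ρg≡a (a≢∅ ∘ sym) z) ⟩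
                deg c b z + deg ρ a z + at-y p z                              ≡⟨ balance z ⟨
                deg c a z + deg ρ b z + u ≐ z + at-y (p ⁻¹) z                 ≡⟨ rearrange′ (deg c a z) (deg ρ b z) (u ≐ z) (at-y (p ⁻¹) z) ⟩
                deg c a z + u ≐ z + deg ρ b z + at-y (p ⁻¹) z                 ≡⟨ cong₂ (λ x y → x + y + at-y (p ⁻¹) z) (sym (a-shift z)) (sym ρ-b) ⟩
                deg c′ a z + v′ ≐ z + deg ρ′ b z + at-y (p ⁻¹) z              ≡⟨ rearrange″ (deg c′ a z) (v′ ≐ z) (deg ρ′ b z) (at-y (p ⁻¹) z) ⟩
                deg c′ a z + deg ρ′ b z + at-y (p ⁻¹) z + v′ ≐ z              ∎)
                where
                open ≡-Reasoning
                rearrange : ∀ a b c d e → a + b + c + d + e ≡ a + (b + (c + e)) + d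
                rearrange = solve-∀
                rearrange′ : ∀ a b c d → a + b + c + d ≡ a + c + b + d
                rearrange′ = solve-∀
                rearrange″ : ∀ a b c d → a + b + c + d ≡ a + c + d + b
                rearrange″ = solve-∀
                ρ-b : deg ρ′ b z ≡ deg ρ b z
                ρ-b = count-other (inc z) ρ (λ eq → a≢b (trans (sym ρg≡a) eq)) (b≢∅ ∘ sym)
              size-loss : size-of ρ′ b + size-of ρ′ a + 1 ≡ size-of ρ a + size-of ρ b
              size-loss = begin
                size-of ρ′ b + size-of ρ′ a + 1    ≡⟨ +-assoc (size-of ρ′ b) _ 1 ⟩
                size-of ρ′ b + (size-of ρ′ a + 1)  ≡⟨ cong₂ _+_ (count-other (λ _ → 1) ρ (λ eq → a≢b (trans (sym ρg≡a) eq)) (b≢∅ ∘ sym)) (count-loss (λ _ → 1) ρ ρg≡a (a≢∅ ∘ sym)) ⟩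
                size-of ρ b + size-of ρ a          ≡⟨ +-comm (size-of ρ b) _ ⟩
                size-of ρ a + size-of ρ b          ∎
                where open ≡-Reasoning
              continue : ∀ n → size-of ρ a + size-of ρ b ≤ n → OddCycle (Arc c₀) ⊎ SimplePath (Arc c₀) u y p
              continue zero size≤0 = ⊥-elim (n≮0 (subst (_≤ 0) (trans (sym size-loss) (+-comm _ 1)) size≤0))
              continue (suc n) size≤n = subst (λ q → OddCycle (Arc c₀) ⊎ SimplePath (Arc c₀) u y q) (⁻¹-involutive p)
                (extend (Arc c₀) Arc.joins arc
                  (oddCycle∨simplePath n c′ ρ′ (p ⁻¹) agree′ good′ (pair-sym pair) jg (≔-here c₁ g ∅)
                    (subst (_< d) (sym (other-same b≢∅ (a≢b ∘ sym) v)) v-misses)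
                    (subst (_≤ d) (trans (cong (deg c′ a v′ +_) ≐-refl) (+-comm _ 1)) (a-bound v′))
                    fresh′ (+-cancelʳ-≤ 1 _ _ (subst₂ _≤_ (sym size-loss) (+-comm 1 n) size≤n)) balance′))

          -- Counting missed colours on the odd cycle

          cycle-bound : ∀ {c} → α ≢ β → (C : OddCycle (Arc c)) → OddCycle.len C * D + 2 ≤ k
          cycle-bound {c} α≢β C = begin
            len * D + 2                                                              ≡⟨ cong (_+ 2) (sum-const len D) ⟨
            sum {len} (λ _ → D) + 2                                                  ≤⟨ +-monoˡ-≤ 2 (sum-mono λ i → rest-deficit (arc i)) ⟩
            -- Double counting: a vertex of the cycle contributes at least `D`, a `Rest` colour at
            -- most 1 by `elementary`, and the summand 2 stands for α and β.
            sum (λ i → sum λ j → misses i j) + 2                                     ≡⟨ cong (_+ 2) (∑-comm misses) ⟩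
            sum (λ j → sum λ i → misses i j) + 2                                     ≤⟨ +-monoˡ-≤ 2 (sum-mono column) ⟩
            sum is-rest + 2                                                          ≡⟨ cong (sum is-rest +_) (cong₂ _+_ (sym (once α≢∅)) (sym (once β≢∅))) ⟩
            sum is-rest + (sum (is α) + sum (is β))                                  ≡⟨ cong (sum is-rest +_) (∑-distrib-+ (is α) (is β)) ⟨
            sum is-rest + sum (λ j → is α j + is β j)                                ≡⟨ ∑-distrib-+ is-rest (λ j → is α j + is β j) ⟨
            sum (λ j → is-rest j + (is α j + is β j))                                ≤⟨ sum-mono disjoint ⟩
            sum {k} (λ _ → 1)                                                        ≡⟨ trans (sum-const k 1) (*-identityʳ k) ⟩
            k                                                                        ∎
            where
            open OddCycle C
            open ≤-Reasoning
            misses : Fin len → Fin k → ℕ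
            misses i j = ι (restMiss? c (lookup vs i) (suc j))
            is-rest : Fin k → ℕ
            is-rest j = ι (rest? (suc j))
            is : Colour → Fin k → ℕ
            is γ j = ι (γ Fin.≟ suc j)
            once : ∀ {γ} → γ ≢ ∅ → sum (is γ) ≡ 1
            once {γ} γ≢∅ = trans (cong (_+ sum (is γ)) (sym (ι-no (γ Fin.≟ ∅) γ≢∅))) (sum-≟ γ)
            column : ∀ j → sum (λ i → misses i j) ≤ is-rest j
            column j with rest? (suc j)
            ... | no ¬r = ≤-reflexive (sum-zero λ i → ι-no (no ¬r ×-dec (deg c (suc j) (lookup vs i) <? d)) λ { (r , _) → ¬r r })
            ... | yes r = sum-ι≤1 (λ i → yes r ×-dec (deg c (suc j) (lookup vs i) <? d)) unique
              where
              unique : ∀ i i′ → RestMiss c (lookup vs i) (suc j) → RestMiss c (lookup vs i′) (suc j) → i ≡ i′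
              unique i i′ (r , m) (_ , m′) with i Fin.≟ i′
              ... | yes eq = eq
              ... | no i≢i′ = ⊥-elim (elementary (linked i i′) (λ a → a) (i≢i′ ∘ lookup-injective (proj₁ cycle) i i′) r m m′)
            disjoint : ∀ j → is-rest j + (is α j + is β j) ≤ 1
            disjoint j with rest? (suc j) | α Fin.≟ suc j | β Fin.≟ suc j
            ... | yes (_ , ≢α , _) | yes eq   | _        = ⊥-elim (≢α (sym eq))
            ... | yes (_ , _ , ≢β) | no _     | yes eq   = ⊥-elim (≢β (sym eq))
            ... | yes _            | no _     | no _     = ≤-refl
            ... | no _             | yes refl | yes refl = ⊥-elim (α≢β refl)
            ... | no _             | yes _    | no _     = ≤-refl
            ... | no _             | no _     | yes _    = ≤-refl
            ... | no _             | no _     | no _     = z≤n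

        short-oddCycle : ∀ {c} → Good c → ∃ λ L → HasOddCycle G L × L * D + 2 ≤ k
        short-oddCycle {c} good with count≡0∨edge (λ _ → 1) c ∅
        ... | inj₁ ≡0 = case trans (sym ≡0) (proj₂ good) of λ ()
        ... | inj₂ (f , _ , cf≡∅) with some-miss c (proj₁ (ends f)) | some-miss c (proj₂ (ends f))
        -- Nothing has been traversed yet, so `ρ` is `c` itself and the trail's current vertex `u`
        -- is `y`: the terms for `u` and `y` cancel in the balance, which fixes the initial parity
        -- as odd.
        ...   | α , α≢∅ , x-miss | β , β≢∅ , y-miss = found (oddCycle∨simplePath α≢∅ β≢∅ c y _ c c 1ℙ (≈-refl α≢∅ β≢∅) good (inj₂ (refl , refl))
                  joins cf≡∅ y-miss x-miss (λ _ → inj₂ refl) ≤-refl λ z → initial (deg c β z) (deg c α z) (y ≐ z))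
          where
          y = proj₂ (ends f)
          joins : Joins G f y (proj₁ (ends f))
          joins = inj₂ refl
          initial : ∀ a b e → a + b + e + 0 ≡ b + a + e
          initial = solve-∀
          α≢β : α ≢ β
          α≢β refl = no-common-miss good cf≡∅ joins α≢∅ y-miss x-miss
          found : OddCycle (Arc α≢∅ β≢∅ c) ⊎ SimplePath (Arc α≢∅ β≢∅ c) y y 1ℙ → ∃ λ L → HasOddCycle G L × L * D + 2 ≤ k
          found (inj₁ C)  = len , (odd , vs , es , cycle) , cycle-bound α≢∅ β≢∅ α≢β C
            where open OddCycle C
          found (inj₂ sp) = ⊥-elim (closed-simplePath-even (Arc α≢∅ β≢∅ c) Arc.joins sp)

      -- Descent to a complete colouring

      Coloured : ℕ → Set
      Coloured n = ∃ λ c → Valid c × size-of c ∅ ≤ n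

      module _ {D : ℕ} (D>0 : D > 0) (degree-bound : ∀ t → degree t + D ≤ k * d)
               (no-short-cycle : ∀ {L} → HasOddCycle G L → ¬ L * D + 2 ≤ k) where

        -- Descent on the number of uncoloured edges replaces the choice of a minimum. Under the
        -- assumption that no complete colouring exists, the induction hypothesis is precisely
        -- `stuck`. Improvement is thus known only by refutation, hence the double negation.
        ¬¬coloured : ∀ n → Coloured n → ¬ ¬ Coloured 0
        ¬¬coloured zero    col no-colouring = no-colouring col
        ¬¬coloured (suc n) (c , valid , size) no-colouring with size-of c ∅ ≤? n
        ... | yes ≤n = ¬¬coloured n (c , valid , ≤n) no-colouring
        ... | no ≰n with Stuck.short-oddCycle D n D>0 degree-bound
                         (λ c valid ≤n → ¬¬coloured n (c , valid , ≤n) no-colouring)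
                         (valid , ≤-antisym size (≰⇒> ≰n))
        ...   | L , cyc , short = no-short-cycle cyc short

        defectiveColourable : DefectiveColourable G d k
        -- Colourability with `k` colours is decidable by finite search, which removes the double
        -- negation; the descent starts with all edges uncoloured.
        defectiveColourable = decidable-stable (defectiveColourable? G d k) λ none →
          ¬¬coloured (size-of (λ _ → ∅) ∅) ((λ _ → ∅) , (λ γ≢∅ t → ≤-trans (≤-reflexive (empty γ≢∅ t)) z≤n) , ≤-refl) (none ∘ realise)
          where
          empty : ∀ {γ} → γ ≢ ∅ → ∀ t → deg (λ _ → ∅) γ t ≡ 0
          empty {γ} γ≢∅ t with count≡0∨edge (inc t) (λ _ → ∅) γ
          ... | inj₁ ≡0             = ≡0
          ... | inj₂ (_ , _ , ∅≡γ) = ⊥-elim (γ≢∅ (sym ∅≡γ))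
          realise : Coloured 0 → DefectiveColourable G d k
          realise (c , valid , size) = tabulate c′ , λ a → max≤v⁺ z≤n (ListAll.map⁺ (ListAll.universal (bound a) (allFin order)))
            where
            coloured : ∀ f → c f ≢ ∅
            coloured f cf≡∅ = <⇒≱ (subst (λ γ → 0 < size-of c γ) cf≡∅ (count-term (λ _ → 1) c f)) size
            c′ : Edge → Fin k
            c′ f = punchOut (coloured f ∘ sym)
            bound : ∀ a v → degreeIn G (colourClass G (tabulate c′) a) v ≤ d
            bound a v = begin
              degreeIn G (colourClass G (tabulate c′) a) v         ≤⟨ length-filter-filter≤ (incident? G v) (λ f → lookup (tabulate c′) f Fin.≟ a) (λ f → f) counted ⟩
              sum (λ f → inc v f * ι (c f Fin.≟ suc a))             ≡⟨ count-def (inc v) c (suc a) ⟨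
              deg c (suc a) v                                       ≤⟨ valid (λ ()) v ⟩
              d                                                     ∎
              where
              open ≤-Reasoning
              counted : ∀ f → Incident G v f → lookup (tabulate c′) f ≡ a → 1 ≤ inc v f * ι (c f Fin.≟ suc a)
              counted f incident f∈a = subst (1 ≤_) (sym (trans (cong (inc v f *_) (ι-yes _ cf≡)) (*-identityʳ _))) (incident⇒inc≥1 incident)
                where
                cf≡ : c f ≡ suc a
                cf≡ = trans (sym (Fin.punchIn-punchOut (coloured f ∘ sym))) (cong suc (trans (sym (lookup∘tabulate c′ f)) f∈a))

-- Ceilings and the final estimates

⌈/⌉-upper : ∀ a b .{{_ : NonZero b}} → a ≤ ⌈ a / b ⌉ * b
⌈/⌉-upper a b = +-cancelʳ-≤ (b ∸ 1) _ _ (begin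
  a + (b ∸ 1)                                     ≡⟨ m≡m%n+[m/n]*n (a + (b ∸ 1)) b ⟩
  (a + (b ∸ 1)) % b + ⌈ a / b ⌉ * b               ≤⟨ +-monoˡ-≤ _ (<⇒≤pred (m%n<n (a + (b ∸ 1)) b)) ⟩
  (b ∸ 1) + ⌈ a / b ⌉ * b                         ≡⟨ +-comm (b ∸ 1) _ ⟩
  ⌈ a / b ⌉ * b + (b ∸ 1)                         ∎)
  where open ≤-Reasoning

corollary3p1 : (G : Multigraph) → ¬ Bipartite G →
    (d : ℕ) .{{_ : NonZero d}} → d > 1 → Odd d →
    (m s : ℕ) → Δ G ≡ m * d + s → s < d →
    let ℓ = 1 ⊔ (Γ G d ∸ m) in
    Σ (ℓ * d ∸ s > 0) λ ℓd-s>0 →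
    (g₀ G ≥ ⌈_/_⌉ (m + ℓ ∸ 1) (ℓ * d ∸ s) {{>-nonZero ℓd-s>0}} →
    (χ′ G d ≤ m + ℓ) × (χ′ G d ≤ Γ G d ⊔ ⌈ (Δ G + 1) / d ⌉))
corollary3p1 G _ d _ _ m s Δ≡ s<d = D>0 , λ g₀-large →
  let χ′≤ = χ′-minimal G d (defectiveColourable G d D>0 degree-bound (no-short-cycle g₀-large))
  in χ′≤ , ≤-trans χ′≤ m+ℓ≤max
  where
  ℓ = 1 ⊔ (Γ G d ∸ m)
  D = ℓ * d ∸ s
  open ≤-Reasoning
  s<ℓd : s < ℓ * d
  s<ℓd = <-≤-trans s<d (≤-trans (≤-reflexive (sym (*-identityˡ d))) (*-monoˡ-≤ d (m≤m⊔n 1 (Γ G d ∸ m))))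
  D>0 : D > 0
  D>0 = m<n⇒0<n∸m s<ℓd
  degree-bound : ∀ t → degree G t + D ≤ (m + ℓ) * d
  degree-bound t = begin
    degree G t + D         ≤⟨ +-monoˡ-≤ D (degree≤Δ G t) ⟩
    Δ G + D                ≡⟨ cong (_+ D) Δ≡ ⟩
    m * d + s + D          ≡⟨ +-assoc (m * d) s D ⟩
    m * d + (s + D)        ≡⟨ cong (m * d +_) (m+[n∸m]≡n (<⇒≤ s<ℓd)) ⟩
    m * d + ℓ * d          ≡⟨ *-distribʳ-+ d m ℓ ⟨
    (m + ℓ) * d            ∎
  -- The girth condition gives `L * D ≥ m + ℓ ∸ 1` for every odd cycle, one more than `cycle-bound`
  -- permits.
  no-short-cycle : g₀ G ≥ ⌈_/_⌉ (m + ℓ ∸ 1) D {{>-nonZero D>0}} → ∀ {L} → HasOddCycle G L → ¬ L * D + 2 ≤ m + ℓ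
  no-short-cycle g₀-large {L} cyc short = <⇒≱ (n<1+n (suc (m + ℓ ∸ 1))) (begin
    2 + (m + ℓ ∸ 1)        ≤⟨ +-monoʳ-≤ 2 (⌈/⌉-upper (m + ℓ ∸ 1) D {{>-nonZero D>0}}) ⟩
    2 + ⌈_/_⌉ (m + ℓ ∸ 1) D {{>-nonZero D>0}} * D  ≤⟨ +-monoʳ-≤ 2 (*-monoˡ-≤ D (≤-trans g₀-large (g₀-minimal G cyc))) ⟩
    2 + L * D              ≡⟨ +-comm 2 (L * D) ⟩
    L * D + 2              ≤⟨ short ⟩
    m + ℓ                  ≤⟨ m≤n+m∸n (m + ℓ) 1 ⟩
    1 + (m + ℓ ∸ 1)        ∎)
  -- The summand 1 in `Δ G + 1` makes the inequality strict even when `s` is 0.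
  m<⌈/⌉ : m < ⌈ (Δ G + 1) / d ⌉
  m<⌈/⌉ = *-cancelʳ-< d m _ (begin-strict
    m * d                          ≤⟨ m≤m+n (m * d) s ⟩
    m * d + s                      ≡⟨ Δ≡ ⟨
    Δ G                            <⟨ ≤-reflexive (+-comm 1 (Δ G)) ⟩
    Δ G + 1                        ≤⟨ ⌈/⌉-upper (Δ G + 1) d ⟩
    ⌈ (Δ G + 1) / d ⌉ * d          ∎)
  m+ℓ≤max : m + ℓ ≤ Γ G d ⊔ ⌈ (Δ G + 1) / d ⌉
  m+ℓ≤max = begin
    m + (1 ⊔ (Γ G d ∸ m))          ≡⟨ +-distribˡ-⊔ m 1 (Γ G d ∸ m) ⟩
    (m + 1) ⊔ (m + (Γ G d ∸ m))    ≤⟨ ⊔-lub (≤-trans m+1≤ (m≤n⊔m (Γ G d) _)) m+[Γ∸m]≤ ⟩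
    Γ G d ⊔ ⌈ (Δ G + 1) / d ⌉      ∎
    where
    m+1≤ : m + 1 ≤ ⌈ (Δ G + 1) / d ⌉
    m+1≤ = ≤-trans (≤-reflexive (+-comm m 1)) m<⌈/⌉
    m+[Γ∸m]≤ : m + (Γ G d ∸ m) ≤ Γ G d ⊔ ⌈ (Δ G + 1) / d ⌉
    m+[Γ∸m]≤ with ≤-total m (Γ G d)
    ... | inj₁ m≤Γ = ≤-trans (≤-reflexive (m+[n∸m]≡n m≤Γ)) (m≤m⊔n (Γ G d) _)
    -- The truncated difference is 0 here, leaving just `m`, which the ceiling already exceeds.
    ... | inj₂ Γ≤m = ≤-trans (≤-reflexive (trans (cong (m +_) (m≤n⇒m∸n≡0 Γ≤m)) (+-identityʳ m))) (≤-trans (<⇒≤ m<⌈/⌉) (m≤n⊔m (Γ G d) _))
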